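{- Let $G$ be a unicyclic graph of order $n\geq 6$. Then $ABC_3(G)\leq n\sqrt{\tfrac12}$, with equality if and only if $G\cong H(n,3;n_1,n_2,n_3)$ for some nonnegative integers $n_1,n_2,n_3$ with $n_1+n_2+n_3=n-3$, or $G\cong H(n,4;n-4,0,0,0)$.
   Context: All graphs are simple and connected. For a vertex $u$ of a graph $G$, the eccentricity $e_G(u)$ is $\max\{d_G(u,v): v\in V(G)\}$, where $d_G$ is the shortest-path distance. $ABC_3(G)=\sum_{uv\in E(G)}\sqrt{\frac{e_G(u)+e_G(v)-2}{e_G(u)e_G(v)}}$. A unicyclic graph is a connected graph with exactly one cycle. For nonnegative integers $n_1,\ldots,n_k$ with $\sum_i n_i=n-k$, $H(n,k;n_1,\ldots,n_k)$ is the unicyclic graph of order $n$ obtained from the cycle $C_k=v_1v_2\cdots v_kv_1$ by attaching $n_i$ new pendent vertices to $v_i$ for each $i=1,\ldots,k$. -}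

module Defs where

open import Data.Bool using (Bool; true; false; _∧_; _∨_; if_then_else_)
open import Data.Nat as ℕ using (ℕ; zero; suc; _∸_; _<ᵇ_; _≡ᵇ_; _⊔_)
open import Data.Fin using (Fin; toℕ)
open import Data.Fin.Properties using () renaming (_≟_ to _≟F_)
open import Data.List using (List; []; _∷_; map; foldr; concatMap; allFin; zip; _++_; length; replicate)
open import Data.Bool.ListAction using (any)
open import Data.List.Relation.Unary.All using (All)
open import Data.List.Relation.Unary.Unique.Propositional using (Unique)
open import Data.List.Membership.Propositional using (_∈_)
open import Data.Product using (Σ; ∃; _×_; _,_)
open import Data.Sum using (_⊎_)
open import Data.Integer using (+_)
open import Data.Rational using (ℚ; _/_; 0ℚ; _+_; _-_; _*_; _≤_; _<_)
open import Relation.Nullary.Decidable using (⌊_⌋)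
open import Relation.Binary.PropositionalEquality using (_≡_)
open import Function.Bundles using (_⇔_; _↔_; Inverse)

Graph : ℕ → Set
Graph n = Fin n → Fin n → Bool

IsSimple : ∀ {n} → Graph n → Set
IsSimple {n} G = (∀ u v → G u v ≡ G v u) × (∀ u → G u u ≡ false)

reach : ∀ {n} → Graph n → ℕ → Fin n → Fin n → Bool
reach G zero    u v = ⌊ u ≟F v ⌋
reach {n} G (suc k) u v = reach G k u v ∨ any (λ w → reach G k u w ∧ G w v) (allFin n)

Connected : ∀ {n} → Graph n → Set
Connected G = ∀ u v → ∃ λ k → reach G k u v ≡ true

-- shortest-path distance: least k (searched among 0..n-1) with a walk of
-- length ≤ k from u to v (value n is never reached for connected graphs)
dist : ∀ {n} → Graph n → Fin n → Fin n → ℕ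
dist {n} G u v = search n 0
  where
  search : ℕ → ℕ → ℕ
  search zero    k = k
  search (suc f) k = if reach G k u v then k else search f (suc k)

ecc : ∀ {n} → Graph n → Fin n → ℕ
ecc {n} G u = foldr _⊔_ 0 (map (dist G u) (allFin n))

cpairs : ∀ {A : Set} → List A → List (A × A)
cpairs []       = []
cpairs (x ∷ xs) = zip (x ∷ xs) (xs ++ (x ∷ []))

IsCycle : ∀ {n} → Graph n → List (Fin n) → Set
IsCycle G vs = (3 ℕ.≤ length vs) × Unique vs
             × All (λ p → G (Data.Product.proj₁ p) (Data.Product.proj₂ p) ≡ true) (cpairs vs)

CycEdge : ∀ {n} → List (Fin n) → Fin n → Fin n → Set
CycEdge vs a b = ((a , b) ∈ cpairs vs) ⊎ ((b , a) ∈ cpairs vs)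

-- connected with exactly one cycle (cycles identified by their edge sets)
Unicyclic : ∀ {n} → Graph n → Set
Unicyclic G = Connected G
  × Σ _ (λ vs → IsCycle G vs
       × (∀ ws → IsCycle G ws → ∀ a b → CycEdge vs a b ⇔ CycEdge ws a b))

-- Finite sums of square roots of nonnegative rationals, compared exactly.
-- A pair (p , q) stands for the real number sqrt (p / q)  (q > 0).
-- RootSum xs = Σ_{(p,q) ∈ xs} sqrt (p/q); we describe it by its (open)
-- lower Dedekind cut:  r < Σ sqrt(p_i/q_i)  iff there are rationals
-- x_i ≥ 0 with x_i² ≤ p_i/q_i and r < Σ x_i.

ℕtoℚ : ℕ → ℚ
ℕtoℚ m = + m / 1

Below : List (ℕ × ℕ) → ℚ → Set
Below []             r = r < 0ℚ
Below ((p , q) ∷ xs) r = ∃ λ x → (0ℚ ≤ x) × (x * x * ℕtoℚ q ≤ ℕtoℚ p) × Below xs (r - x)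

_≤√_ : List (ℕ × ℕ) → List (ℕ × ℕ) → Set
xs ≤√ ys = ∀ r → Below xs r → Below ys r

_≈√_ : List (ℕ × ℕ) → List (ℕ × ℕ) → Set
xs ≈√ ys = (xs ≤√ ys) × (ys ≤√ xs)

abc3Terms : ∀ {n} → Graph n → List (ℕ × ℕ)
abc3Terms {n} G =
  concatMap (λ u → concatMap (λ v →
      if (toℕ u <ᵇ toℕ v) ∧ G u v
      then ((ecc G u ℕ.+ ecc G v ∸ 2 , ecc G u ℕ.* ecc G v) ∷ [])
      else []) (allFin n)) (allFin n)

nSqrtHalf : ℕ → List (ℕ × ℕ)
nSqrtHalf n = replicate n (1 , 2)

-- H(n,k;n_1,...,n_k): vertices 0..k-1 are the cycle v_1..v_k (v_i ↦ i-1),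
-- vertices k..n-1 are the pendent vertices; the first n_1 of them are
-- attached to v_1, the next n_2 to v_2, etc.

block : List ℕ → ℕ → ℕ
block []       t = 0
block (m ∷ ns) t = if t <ᵇ m then 0 else suc (block ns (t ∸ m))

Hadj : (n k : ℕ) → List ℕ → ℕ → ℕ → Bool
Hadj n k ns a b =
  if (a <ᵇ k) ∧ (b <ᵇ k) then (nextOnCycle a b ∨ nextOnCycle b a)
  else if (a <ᵇ k) then (block ns (b ∸ k) ≡ᵇ a)
  else if (b <ᵇ k) then (block ns (a ∸ k) ≡ᵇ b)
  else false
  where
  nextOnCycle : ℕ → ℕ → Bool
  nextOnCycle x y = (suc x ≡ᵇ y) ∨ ((suc x ≡ᵇ k) ∧ (y ≡ᵇ 0))

H : (n k : ℕ) → List ℕ → Graph n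
H n k ns u v = Hadj n k ns (toℕ u) (toℕ v)

_≅_ : ∀ {n} → Graph n → Graph n → Set
_≅_ {n} G K = Σ (Fin n ↔ Fin n) λ σ →
  ∀ u v → G (Inverse.to σ u) (Inverse.to σ v) ≡ K u v

{-# OPTIONS --safe #-}

-- An edge whose ends have eccentricities a and b contributes √((a + b − 2)/(a b)) ≤ √½, because
-- (a − 2)(b − 2) ≥ 0 unless one of them is 1, and then the other is at most 2; if a, b ≥ 3 the
-- contribution is at most 2/3 < √½.  A unicyclic graph has n edges: orient the cycle, and let
-- every other vertex own its first edge towards the cycle.  Hence the bound, with equality iff
-- every edge has an end of eccentricity at most 2.  As there is only one cycle, a path of length
-- three with ends at distance at most two has to close up along that cycle.  This rules out
-- cycles of length at least 5, leaves a single hub on a 4-cycle, and forces all the vertices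
-- off a triangle to be pendent.
module Submission where

open import Defs
open import Data.Bool using (Bool; true; false; T; T?; _∧_; if_then_else_)
import Data.Bool.Properties as Bool
open import Data.Bool.Properties using (T-≡; T-∧; T-∨)
open import Data.Empty using (⊥; ⊥-elim)
open import Data.Fin using (Fin; zero; suc; toℕ; cast)
import Data.Fin.Properties as Fin
open import Data.List using (List; []; _∷_; _++_; map; foldr; filter; length; lookup; allFin; concat; concatMap; zip; cartesianProduct)
open import Data.List.Membership.Propositional using (_∈_; _∉_; lose; find)
open import Data.List.Membership.Propositional.Properties
  using (∈-allFin; ∈-map⁺; ∈-map⁻; ∈-filter⁺; ∈-filter⁻; ∈-cartesianProduct⁺; ∈-∃++; ∈-++⁺ˡ; ∈-++⁺ʳ; ∈-++⁻; ∈-concat⁺′; ∈-concat⁻′)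
open import Data.List.Properties using (map-++; filter-++; length-map; length-tabulate; length-++; length-++-sucʳ; ++-identityʳ)
open import Data.List.Relation.Unary.All as All using (All; []; _∷_)
import Data.List.Relation.Unary.All.Properties as All
open import Data.List.Relation.Unary.AllPairs using ([]; _∷_)
open import Data.List.Relation.Unary.Any using (Any; here; there; index)
open import Data.List.Relation.Unary.Any.Properties using (any⁺; any⁻)
open import Data.List.Relation.Unary.Unique.Propositional using (Unique)
import Data.List.Relation.Unary.Unique.Propositional.Properties as Unique
open import Data.Nat as ℕ using (ℕ; zero; suc; z≤n; s≤s; _∸_; _<ᵇ_; _≡ᵇ_)
import Data.Nat.Properties as ℕ
open import Data.Nat.Solver using (module +-*-Solver)
open import Data.Product using (Σ; ∃; _×_; _,_; proj₁; proj₂)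
open import Data.Product.Properties using (≡-dec)
open import Data.Sum as Sum using (_⊎_; inj₁; inj₂)
open import Function.Bundles using (_⇔_; _↔_; mk⇔; mk↔ₛ′; Equivalence; Inverse)
open import Relation.Binary.Construct.Closure.ReflexiveTransitive using (Star; ε; _◅_; _◅◅_; reverse)
open import Relation.Binary.Definitions using (tri<; tri≈; tri>)
open import Relation.Binary.PropositionalEquality
open import Relation.Nullary using (Dec; yes; no; ¬_)
open import Relation.Nullary.Decidable using (toWitness; fromWitness; _×-dec_; ¬?)

open Equivalence using (to; from)

-- The orders `≤√` and `≈√` compare open lower cuts, so no real number is ever formed. A non-strict
-- inequality passes the rational witness of each term on unchanged. Strictness is the obstacle: it
-- needs one rational that lies in one cut and not in the other, although the single term bounded by
-- 2/3 stands among many that may equal the irrational √½. Hence √½ is enclosed between fractions so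
-- fine that the total error over n terms stays below √½ - 2/3. The condition for equality is
-- carried as `Dominated`, which mentions only adjacency. It therefore passes along isomorphisms,
-- and eccentricities enter only when the graph theory is tied to the sum. That step also has to
-- exclude adjacent vertices of eccentricity 1, whose edge would contribute 0. The edge sets of
-- cycles matter only for counting edges. The structural part uses a weaker consequence of
-- uniqueness, that all cycles have the same vertices: a cycle is refuted by a vertex that it
-- contains or misses.

module Roots where

  open import Data.Integer as ℤ using (+_)
  import Data.Integer.Properties as ℤ
  open import Data.Rational
  open import Data.Rational.Properties
  open import Data.Rational.Solver using () renaming (module +-*-Solver to ℚ-Solver)
  import Data.Rational.Unnormalised as ℚᵘ
  import Data.Rational.Unnormalised.Properties as ℚᵘ

  -- Sums of square roots compared through rational witnesses

  ℕtoℚ-ᵘ : ∀ m → toℚᵘ (ℕtoℚ m) ℚᵘ.≃ ℚᵘ.mkℚᵘ (+ m) 0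
  ℕtoℚ-ᵘ m = toℚᵘ-fromℚᵘ (ℚᵘ.mkℚᵘ (+ m) 0)

  ℕtoℚ-+ : ∀ m n → ℕtoℚ (m ℕ.+ n) ≡ ℕtoℚ m + ℕtoℚ n
  ℕtoℚ-+ m n = toℚᵘ-injective (begin
    toℚᵘ (ℕtoℚ (m ℕ.+ n))                          ≈⟨ ℕtoℚ-ᵘ (m ℕ.+ n) ⟩
    ℚᵘ.mkℚᵘ (+ (m ℕ.+ n)) 0                        ≈⟨ ℚᵘ.*≡* (cong (ℤ._* + 1) (cong₂ ℤ._+_ (sym (ℤ.*-identityʳ (+ m))) (sym (ℤ.*-identityʳ (+ n))))) ⟩
    ℚᵘ.mkℚᵘ (+ m) 0 ℚᵘ.+ ℚᵘ.mkℚᵘ (+ n) 0            ≈⟨ ℚᵘ.+-cong (ℕtoℚ-ᵘ m) (ℕtoℚ-ᵘ n) ⟨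
    toℚᵘ (ℕtoℚ m) ℚᵘ.+ toℚᵘ (ℕtoℚ n)               ≈⟨ toℚᵘ-homo-+ (ℕtoℚ m) (ℕtoℚ n) ⟨
    toℚᵘ (ℕtoℚ m + ℕtoℚ n)                         ∎)
    where open import Relation.Binary.Reasoning.Setoid ℚᵘ.≃-setoid

  ℕtoℚ-* : ∀ m n → ℕtoℚ (m ℕ.* n) ≡ ℕtoℚ m * ℕtoℚ n
  ℕtoℚ-* m n = toℚᵘ-injective (begin
    toℚᵘ (ℕtoℚ (m ℕ.* n))                          ≈⟨ ℕtoℚ-ᵘ (m ℕ.* n) ⟩
    ℚᵘ.mkℚᵘ (+ (m ℕ.* n)) 0                        ≈⟨ ℚᵘ.*≡* (cong (ℤ._* + 1) (ℤ.pos-* m n)) ⟩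
    ℚᵘ.mkℚᵘ (+ m) 0 ℚᵘ.* ℚᵘ.mkℚᵘ (+ n) 0            ≈⟨ ℚᵘ.*-cong (ℕtoℚ-ᵘ m) (ℕtoℚ-ᵘ n) ⟨
    toℚᵘ (ℕtoℚ m) ℚᵘ.* toℚᵘ (ℕtoℚ n)               ≈⟨ toℚᵘ-homo-* (ℕtoℚ m) (ℕtoℚ n) ⟨
    toℚᵘ (ℕtoℚ m * ℕtoℚ n)                         ∎)
    where open import Relation.Binary.Reasoning.Setoid ℚᵘ.≃-setoid

  ℕtoℚ-mono-≤ : ∀ {m n} → m ℕ.≤ n → ℕtoℚ m ≤ ℕtoℚ n
  ℕtoℚ-mono-≤ {m} {n} m≤n = toℚᵘ-cancel-≤ (begin
    toℚᵘ (ℕtoℚ m)      ≃⟨ ℕtoℚ-ᵘ m ⟩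
    ℚᵘ.mkℚᵘ (+ m) 0    ≤⟨ ℚᵘ.*≤* (ℤ.*-monoʳ-≤-nonNeg (+ 1) (ℤ.+≤+ m≤n)) ⟩
    ℚᵘ.mkℚᵘ (+ n) 0    ≃⟨ ℕtoℚ-ᵘ n ⟨
    toℚᵘ (ℕtoℚ n)      ∎)
    where open ℚᵘ.≤-Reasoning

  ℕtoℚ-mono-< : ∀ {m n} → m ℕ.< n → ℕtoℚ m < ℕtoℚ n
  ℕtoℚ-mono-< {m} {n} m<n = toℚᵘ-cancel-< (begin-strict
    toℚᵘ (ℕtoℚ m)      ≃⟨ ℕtoℚ-ᵘ m ⟩
    ℚᵘ.mkℚᵘ (+ m) 0    <⟨ ℚᵘ.*<* (ℤ.*-monoʳ-<-pos (+ 1) (ℤ.+<+ m<n)) ⟩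
    ℚᵘ.mkℚᵘ (+ n) 0    ≃⟨ ℕtoℚ-ᵘ n ⟨
    toℚᵘ (ℕtoℚ n)      ∎)
    where open ℚᵘ.≤-Reasoning

  ℕtoℚ-nonNeg : ∀ m → NonNegative (ℕtoℚ m)
  ℕtoℚ-nonNeg m = nonNegative (ℕtoℚ-mono-≤ {0} {m} z≤n)

  ℕtoℚ-pos : ∀ {m} → 0 ℕ.< m → Positive (ℕtoℚ m)
  ℕtoℚ-pos {m} 0<m = positive (ℕtoℚ-mono-< 0<m)

  -- This is x² ≤ p/q ≤ p′/q′ with denominators cleared: multiply the goal by q, compare, and cancel
  -- the positive q.
  square-bound : ∀ {x p q p′ q′} → 0 ℕ.< q → p ℕ.* q′ ℕ.≤ p′ ℕ.* q →
                 x * x * ℕtoℚ q ≤ ℕtoℚ p → x * x * ℕtoℚ q′ ≤ ℕtoℚ p′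
  square-bound {x} {p} {q} {p′} {q′} 0<q pq′≤p′q h =
    *-cancelʳ-≤-pos (ℕtoℚ q) {{ℕtoℚ-pos 0<q}} (begin
      x * x * ℕtoℚ q′ * ℕtoℚ q   ≡⟨ *-assoc (x * x) _ _ ⟩
      x * x * (ℕtoℚ q′ * ℕtoℚ q) ≡⟨ cong (x * x *_) (*-comm (ℕtoℚ q′) (ℕtoℚ q)) ⟩
      x * x * (ℕtoℚ q * ℕtoℚ q′) ≡⟨ *-assoc (x * x) _ _ ⟨
      x * x * ℕtoℚ q * ℕtoℚ q′   ≤⟨ *-monoʳ-≤-nonNeg (ℕtoℚ q′) {{ℕtoℚ-nonNeg q′}} h ⟩
      ℕtoℚ p * ℕtoℚ q′           ≡⟨ ℕtoℚ-* p q′ ⟨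
      ℕtoℚ (p ℕ.* q′)            ≤⟨ ℕtoℚ-mono-≤ pq′≤p′q ⟩
      ℕtoℚ (p′ ℕ.* q)            ≡⟨ ℕtoℚ-* p′ q ⟩
      ℕtoℚ p′ * ℕtoℚ q           ∎)
    where open ≤-Reasoning

  HalfBounded : ℕ × ℕ → Set
  HalfBounded (p , q) = 0 ℕ.< q × p ℕ.* 2 ℕ.≤ 1 ℕ.* q

  Below-padding : ∀ n {r} → r < 0ℚ → Below (nSqrtHalf n) r
  Below-padding zero    r<0 = r<0
  Below-padding (suc n) {r} r<0 =
    0ℚ , ≤-refl , ℕtoℚ-mono-≤ {0} {1} z≤n , Below-padding n (subst (_< 0ℚ) (sym (+-identityʳ r)) r<0)

  -- A rational below the root of a term is also below √½ and serves unchanged; surplus copies of √½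
  -- receive the witness 0.
  ≤√-half : ∀ {xs n} → All HalfBounded xs → length xs ℕ.≤ n → xs ≤√ nSqrtHalf n
  ≤√-half {n = n} [] _ r r<0 = Below-padding n r<0
  ≤√-half {(p , q) ∷ _} {suc n} ((0<q , 2p≤q) ∷ hs) (s≤s l) r (x , 0≤x , h , b) =
    x , 0≤x , square-bound {x} {p} {q} {1} {2} 0<q 2p≤q h , ≤√-half hs l (r - x) b

  half-≤√ : ∀ {xs} → All (λ (p , q) → 1 ℕ.* q ℕ.≤ p ℕ.* 2) xs → nSqrtHalf (length xs) ≤√ xs
  half-≤√ [] r b = b
  half-≤√ {(p , q) ∷ _} (q≤2p ∷ hs) r (x , 0≤x , h , b) =
    x , 0≤x , square-bound {x} {1} {2} {p} {q} (s≤s z≤n) q≤2p h , half-≤√ hs (r - x) b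

  square-cancel-≤ : ∀ {x y} → 0ℚ ≤ y → x * x ≤ y * y → x ≤ y
  square-cancel-≤ {x} {y} 0≤y xx≤yy = ≮⇒≥ λ y<x →
    <-irrefl refl (<-≤-trans (begin-strict
      y * y  ≤⟨ *-monoʳ-≤-nonNeg y {{nonNegative 0≤y}} (<⇒≤ y<x) ⟩
      x * y  <⟨ *-monoʳ-<-pos x {{positive (≤-<-trans 0≤y y<x)}} y<x ⟩
      x * x ∎) xx≤yy)
    where open ≤-Reasoning

  last-true : ∀ {P : ℕ → Set} → (∀ a → Dec (P a)) → P 0 → ∀ b → ¬ P b → ∃ λ a → P a × ¬ P (suc a)
  last-true P? p₀ zero    ¬p = ⊥-elim (¬p p₀)
  last-true P? p₀ (suc b) ¬p with P? b
  ... | yes p = b , p , ¬p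
  ... | no ¬q = last-true P? p₀ b ¬q

  ⌊√½_⌋ : ∀ c → ∃ λ a → a ℕ.* a ℕ.* 2 ℕ.≤ c ℕ.* c × c ℕ.* c ℕ.< suc a ℕ.* suc a ℕ.* 2
  -- The search starts at c + 1, which is too large because c² < 2 (c + 1)².
  ⌊√½ c ⌋ with last-true (λ a → a ℕ.* a ℕ.* 2 ℕ.≤? c ℕ.* c) z≤n (suc c)
                   (ℕ.<⇒≱ (ℕ.<-≤-trans (ℕ.*-mono-< (ℕ.n<1+n c) (ℕ.n<1+n c)) (ℕ.m≤m*n _ 2)))
  ... | a , lo , hi = a , lo , ℕ.≰⇒> hi

  -- Divided by 3c, the conclusion reads n/c + 2/3 < A/c. Since 2 · 53² = 5618 < 5625 = 75², √½
  -- exceeds 53/75 = 2/3 + 1/25, and n/c < 1/25. The number 25 is the least integer whose reciprocal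
  -- fits below √½ - 2/3.
  approx-bound : ∀ n A → let c = 25 ℕ.* suc n in c ℕ.* c ℕ.< A ℕ.* A ℕ.* 2 → 3 ℕ.* n ℕ.+ 2 ℕ.* c ℕ.< 3 ℕ.* A
  approx-bound n A c²<2A² = ℕ.≰⇒> λ 3A≤ → ℕ.<-irrefl refl (begin-strict
    5618 ℕ.* (N ℕ.* N)          ≤⟨ ℕ.*-monoˡ-≤ (N ℕ.* N) (ℕ.m≤m+n 5618 7) ⟩
    5625 ℕ.* (N ℕ.* N)          ≡⟨ solve 1 (λ N → con 5625 :* (N :* N) := con 9 :* ((con 25 :* N) :* (con 25 :* N))) refl N ⟩
    9 ℕ.* (c ℕ.* c)             <⟨ ℕ.*-monoʳ-< 9 c²<2A² ⟩
    9 ℕ.* (A ℕ.* A ℕ.* 2)       ≡⟨ solve 1 (λ A → con 9 :* (A :* A :* con 2) := con 2 :* ((con 3 :* A) :* (con 3 :* A))) refl A ⟩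
    2 ℕ.* (3 ℕ.* A ℕ.* (3 ℕ.* A)) ≤⟨ ℕ.*-monoʳ-≤ 2 (ℕ.*-mono-≤ (3A≤53N 3A≤) (3A≤53N 3A≤)) ⟩
    2 ℕ.* (53 ℕ.* N ℕ.* (53 ℕ.* N)) ≡⟨ solve 1 (λ N → con 2 :* ((con 53 :* N) :* (con 53 :* N)) := con 5618 :* (N :* N)) refl N ⟩
    5618 ℕ.* (N ℕ.* N)          ∎)
    where
    open ℕ.≤-Reasoning
    open +-*-Solver
    N c : ℕ
    N = suc n
    c = 25 ℕ.* N
    3A≤53N : 3 ℕ.* A ℕ.≤ 3 ℕ.* n ℕ.+ 2 ℕ.* c → 3 ℕ.* A ℕ.≤ 53 ℕ.* N
    3A≤53N h = begin
      3 ℕ.* A               ≤⟨ h ⟩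
      3 ℕ.* n ℕ.+ 2 ℕ.* c   ≤⟨ ℕ.+-monoˡ-≤ (2 ℕ.* c) (ℕ.*-monoʳ-≤ 3 (ℕ.n≤1+n n)) ⟩
      3 ℕ.* N ℕ.+ 2 ℕ.* c   ≡⟨ solve 1 (λ N → con 3 :* N :+ con 2 :* (con 25 :* N) := con 53 :* N) refl N ⟩
      53 ℕ.* N              ∎

  <-minus⇒ : ∀ r x {y} → r - x < y → r < y + x
  <-minus⇒ r x {y} h = subst (_< y + x) eq (+-monoˡ-< x h)
    where
    eq : r - x + x ≡ r
    eq = solve 2 (λ r x → r :- x :+ x := r) refl r x
      where open ℚ-Solver

  <-plus⇒ : ∀ {r} x y → r < y + x → r - x < y
  <-plus⇒ {r} x y h = subst (r - x <_) eq (+-monoˡ-< (- x) h)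
    where
    eq : y + x - x ≡ y
    eq = solve 2 (λ y x → y :+ x :- x := y) refl y x
      where open ℚ-Solver

  suc-* : ∀ n t → ℕtoℚ (suc n) * t ≡ ℕtoℚ n * t + t
  suc-* n t = begin
    ℕtoℚ (suc n) * t     ≡⟨ cong (_* t) (ℕtoℚ-+ 1 n) ⟩
    (1ℚ + ℕtoℚ n) * t    ≡⟨ solve 2 (λ m t → (con 1ℚ :+ m) :* t := m :* t :+ t) refl (ℕtoℚ n) t ⟩
    ℕtoℚ n * t + t       ∎
    where
    open ≡-Reasoning
    open ℚ-Solver

  ⅔ : ℚ
  ⅔ = + 2 / 3

  module _ {t : ℚ} (0≤t : 0ℚ ≤ t) (1≤2t² : 1ℚ ≤ t * t * ℕtoℚ 2) where

    root≤t : ∀ {x} p q → HalfBounded (p , q) → x * x * ℕtoℚ q ≤ ℕtoℚ p → x ≤ t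
    root≤t {x} p q (0<q , 2p≤q) h = square-cancel-≤ 0≤t
      (*-cancelʳ-≤-pos (ℕtoℚ 2) (≤-trans (square-bound {x} {p} {q} {1} {2} 0<q 2p≤q h) 1≤2t²))

    Below⇒< : ∀ {xs r} → All HalfBounded xs → Below xs r → r < ℕtoℚ (length xs) * t
    Below⇒< [] r<0 = subst (_ <_) (sym (*-zeroˡ t)) r<0
    Below⇒< {(p , q) ∷ xs} {r} (b ∷ bs) (x , _ , h , below) = begin-strict
      r                            <⟨ <-minus⇒ r x (Below⇒< bs below) ⟩
      ℕtoℚ (length xs) * t + x     ≤⟨ +-monoʳ-≤ (ℕtoℚ (length xs) * t) (root≤t p q b h) ⟩
      ℕtoℚ (length xs) * t + t     ≡⟨ suc-* (length xs) t ⟨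
      ℕtoℚ (suc (length xs)) * t   ∎
      where open ≤-Reasoning

    -- The term at most 4/9 contributes at most ⅔ where `Below⇒<` would count t. Adding t on the
    -- left avoids the length minus one.
    Below⇒<-strict : ∀ {xs r} → All HalfBounded xs → Any (λ (p , q) → p ℕ.* 9 ℕ.≤ 4 ℕ.* q) xs →
                     Below xs r → r + t < ℕtoℚ (length xs) * t + ⅔
    Below⇒<-strict {(p , q) ∷ xs} {r} ((0<q , _) ∷ bs) (here 9p≤4q) (x , _ , h , below) = begin-strict
      r + t                          <⟨ +-monoˡ-< t (<-minus⇒ r x (Below⇒< bs below)) ⟩
      ℕtoℚ (length xs) * t + x + t   ≤⟨ +-monoˡ-≤ t (+-monoʳ-≤ (ℕtoℚ (length xs) * t) x≤⅔) ⟩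
      ℕtoℚ (length xs) * t + ⅔ + t   ≡⟨ solve 3 (λ a b c → a :+ b :+ c := a :+ c :+ b) refl (ℕtoℚ (length xs) * t) ⅔ t ⟩
      ℕtoℚ (length xs) * t + t + ⅔   ≡⟨ cong (_+ ⅔) (suc-* (length xs) t) ⟨
      ℕtoℚ (suc (length xs)) * t + ⅔ ∎
      where
      open ≤-Reasoning
      open ℚ-Solver
      x≤⅔ : x ≤ ⅔
      x≤⅔ = square-cancel-≤ (*≤* (ℤ.+≤+ z≤n))
        (*-cancelʳ-≤-pos (ℕtoℚ 9) (square-bound {x} {p} {q} {4} {9} 0<q 9p≤4q h))
    Below⇒<-strict {(p , q) ∷ xs} {r} (b ∷ bs) (there any) (x , _ , h , below) = begin-strict
      r + t                          ≡⟨ solve 3 (λ r x t → r :+ t := (r :- x) :+ t :+ x) refl r x t ⟩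
      (r - x) + t + x                <⟨ +-monoˡ-< x (Below⇒<-strict bs any below) ⟩
      ℕtoℚ (length xs) * t + ⅔ + x   ≤⟨ +-monoʳ-≤ (ℕtoℚ (length xs) * t + ⅔) (root≤t p q b h) ⟩
      ℕtoℚ (length xs) * t + ⅔ + t   ≡⟨ solve 3 (λ a b c → a :+ b :+ c := a :+ c :+ b) refl (ℕtoℚ (length xs) * t) ⅔ t ⟩
      ℕtoℚ (length xs) * t + t + ⅔   ≡⟨ cong (_+ ⅔) (suc-* (length xs) t) ⟨
      ℕtoℚ (suc (length xs)) * t + ⅔ ∎
      where
      open ≤-Reasoning
      open ℚ-Solver

  <⇒Below : ∀ {s} → 0ℚ ≤ s → s * s * ℕtoℚ 2 ≤ 1ℚ → ∀ n {r} → r < ℕtoℚ n * s → Below (nSqrtHalf n) r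
  <⇒Below {s} 0≤s h zero    r< = subst (_ <_) (*-zeroˡ s) r<
  <⇒Below {s} 0≤s h (suc n) r< = s , 0≤s , h , <⇒Below 0≤s h n (<-plus⇒ s (ℕtoℚ n * s) (subst (_ <_) (suc-* n s) r<))

  -- With a = ⌊c√½⌋, s = a/c and t = (a + 1)/c enclose √½.  The n-fold sum of s exceeds
  -- (n − 1) t + ⅔ once n/c < t − ⅔, and c = 25 (n + 1) is large enough for that.
  half-≰√ : ∀ {xs n} → All HalfBounded xs → length xs ℕ.≤ n →
            Any (λ (p , q) → p ℕ.* 9 ℕ.≤ 4 ℕ.* q) xs → ¬ (nSqrtHalf n ≤√ xs)
  half-≰√ {xs} {n} bs len any half≤ with ⌊√½ 25 ℕ.* suc n ⌋
  ... | a , 2a²≤c² , c²<2A² = <-irrefl refl (begin-strict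
      n′ * t + ⅔                       ≡⟨ solve 3 (λ x y z → x :+ y := x :+ y :- z :+ z) refl (n′ * t) ⅔ t ⟩
      r + t                            <⟨ Below⇒<-strict 0≤t 1≤2t² bs any (half≤ r (<⇒Below 0≤s 2s²≤1 n r<)) ⟩
      ℕtoℚ (length xs) * t + ⅔         ≤⟨ +-monoˡ-≤ ⅔ (*-monoʳ-≤-nonNeg t {{nonNegative 0≤t}} (ℕtoℚ-mono-≤ len)) ⟩
      n′ * t + ⅔                       ∎)
    where
    open ≤-Reasoning
    open ℚ-Solver
    c : ℕ
    c = 25 ℕ.* suc n
    instance
      c-pos : Positive (ℕtoℚ c)
      c-pos = ℕtoℚ-pos {c} (s≤s z≤n)
      c-nonZero : NonZero (ℕtoℚ c)
      c-nonZero = pos⇒nonZero (ℕtoℚ c)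
    n′ δ s t r : ℚ
    n′ = ℕtoℚ n
    δ = 1/ ℕtoℚ c
    s = ℕtoℚ a * δ
    t = ℕtoℚ (suc a) * δ
    r = n′ * t + ⅔ - t
    instance
      δ-pos : Positive δ
      δ-pos = 1/pos⇒pos (ℕtoℚ c)
      δ-nonNeg : NonNegative δ
      δ-nonNeg = pos⇒nonNeg δ
    cδ≡1 : ℕtoℚ c * δ ≡ 1ℚ
    cδ≡1 = *-inverseʳ (ℕtoℚ c)
    scaled-nonNeg : ∀ b → 0ℚ ≤ ℕtoℚ b * δ
    scaled-nonNeg b = subst (_≤ ℕtoℚ b * δ) (*-zeroˡ δ) (*-monoʳ-≤-nonNeg δ (ℕtoℚ-mono-≤ {0} {b} z≤n))
    0≤s : 0ℚ ≤ s
    0≤s = scaled-nonNeg a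
    0≤t : 0ℚ ≤ t
    0≤t = scaled-nonNeg (suc a)
    scaled-square : ∀ b → ℕtoℚ b * δ * (ℕtoℚ b * δ) * ℕtoℚ 2 ≡ ℕtoℚ (b ℕ.* b ℕ.* 2) * δ * δ
    scaled-square b = begin-equality
      ℕtoℚ b * δ * (ℕtoℚ b * δ) * ℕtoℚ 2     ≡⟨ solve 3 (λ b e d → b :* e :* (b :* e) :* d := b :* b :* d :* e :* e) refl (ℕtoℚ b) δ (ℕtoℚ 2) ⟩
      ℕtoℚ b * ℕtoℚ b * ℕtoℚ 2 * δ * δ       ≡⟨ cong (λ z → z * ℕtoℚ 2 * δ * δ) (ℕtoℚ-* b b) ⟨
      ℕtoℚ (b ℕ.* b) * ℕtoℚ 2 * δ * δ        ≡⟨ cong (λ z → z * δ * δ) (ℕtoℚ-* (b ℕ.* b) 2) ⟨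
      ℕtoℚ (b ℕ.* b ℕ.* 2) * δ * δ           ∎
    c²δ² : ℕtoℚ (c ℕ.* c) * δ * δ ≡ 1ℚ
    c²δ² = begin-equality
      ℕtoℚ (c ℕ.* c) * δ * δ             ≡⟨ cong (λ z → z * δ * δ) (ℕtoℚ-* c c) ⟩
      ℕtoℚ c * ℕtoℚ c * δ * δ            ≡⟨ solve 2 (λ c e → c :* c :* e :* e := (c :* e) :* (c :* e)) refl (ℕtoℚ c) δ ⟩
      (ℕtoℚ c * δ) * (ℕtoℚ c * δ)        ≡⟨ cong₂ _*_ cδ≡1 cδ≡1 ⟩
      1ℚ                                 ∎
    scale² : ∀ {b d} → b ℕ.≤ d → ℕtoℚ b * δ * δ ≤ ℕtoℚ d * δ * δ
    scale² b≤d = *-monoʳ-≤-nonNeg δ (*-monoʳ-≤-nonNeg δ (ℕtoℚ-mono-≤ b≤d))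
    2s²≤1 : s * s * ℕtoℚ 2 ≤ 1ℚ
    2s²≤1 = subst₂ _≤_ (sym (scaled-square a)) c²δ² (scale² 2a²≤c²)
    1≤2t² : 1ℚ ≤ t * t * ℕtoℚ 2
    1≤2t² = subst₂ _≤_ c²δ² (sym (scaled-square (suc a))) (scale² (ℕ.<⇒≤ c²<2A²))
    nδ+⅔<t : n′ * δ + ⅔ < t
    nδ+⅔<t = *-cancelˡ-<-nonNeg (ℕtoℚ 3) (begin-strict
      ℕtoℚ 3 * (n′ * δ + ⅔)                        ≡⟨ solve 2 (λ n e → con (ℕtoℚ 3) :* (n :* e :+ con ⅔) := con (ℕtoℚ 3) :* n :* e :+ con (ℕtoℚ 2) :* con 1ℚ) refl n′ δ ⟩
      ℕtoℚ 3 * n′ * δ + ℕtoℚ 2 * 1ℚ                ≡⟨ cong (λ z → ℕtoℚ 3 * n′ * δ + ℕtoℚ 2 * z) cδ≡1 ⟨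
      ℕtoℚ 3 * n′ * δ + ℕtoℚ 2 * (ℕtoℚ c * δ)      ≡⟨ solve 3 (λ n e c → con (ℕtoℚ 3) :* n :* e :+ con (ℕtoℚ 2) :* (c :* e) := (con (ℕtoℚ 3) :* n :+ con (ℕtoℚ 2) :* c) :* e) refl n′ δ (ℕtoℚ c) ⟩
      (ℕtoℚ 3 * n′ + ℕtoℚ 2 * ℕtoℚ c) * δ          ≡⟨ cong (_* δ) (cong₂ _+_ (ℕtoℚ-* 3 n) (ℕtoℚ-* 2 c)) ⟨
      (ℕtoℚ (3 ℕ.* n) + ℕtoℚ (2 ℕ.* c)) * δ        ≡⟨ cong (_* δ) (ℕtoℚ-+ (3 ℕ.* n) (2 ℕ.* c)) ⟨
      ℕtoℚ (3 ℕ.* n ℕ.+ 2 ℕ.* c) * δ               <⟨ *-monoˡ-<-pos δ (ℕtoℚ-mono-< (approx-bound n (suc a) c²<2A²)) ⟩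
      ℕtoℚ (3 ℕ.* suc a) * δ                       ≡⟨ cong (_* δ) (ℕtoℚ-* 3 (suc a)) ⟩
      ℕtoℚ 3 * ℕtoℚ (suc a) * δ                    ≡⟨ *-assoc (ℕtoℚ 3) (ℕtoℚ (suc a)) δ ⟩
      ℕtoℚ 3 * t                                   ∎)
    r< : r < n′ * s
    r< = <-plus⇒ t (n′ * s) (begin-strict
      n′ * t + ⅔               ≡⟨ cong (λ z → n′ * z + ⅔) (suc-* a δ) ⟩
      n′ * (s + δ) + ⅔         ≡⟨ solve 4 (λ n s e y → n :* (s :+ e) :+ y := n :* s :+ (n :* e :+ y)) refl n′ s δ ⅔ ⟩
      n′ * s + (n′ * δ + ⅔)    <⟨ +-monoʳ-< (n′ * s) nδ+⅔<t ⟩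
      n′ * s + t               ∎)

open import Data.Nat using (_≤_; _<_; _+_; _*_; _⊔_)
open Roots using (HalfBounded; ≤√-half; half-≤√; half-≰√)

-- Bounds for the term of a single edge

half-bound : ∀ {a b} → 1 ≤ a → 1 ≤ b → (a ≤ 1 → b ≤ 2) → (b ≤ 1 → a ≤ 2) → (a + b ∸ 2) * 2 ≤ 1 * (a * b)
half-bound {1} {1} _ _ _ _ = z≤n
half-bound {1} {2} _ _ _ _ = ℕ.≤-refl
half-bound {1} {suc (suc (suc b))} _ _ h _ with s≤s (s≤s ()) ← h ℕ.≤-refl
half-bound {2} {1} _ _ _ _ = ℕ.≤-refl
half-bound {suc (suc (suc a))} {1} _ _ _ h with s≤s (s≤s ()) ← h ℕ.≤-refl
half-bound {suc (suc a)} {suc (suc b)} _ _ _ _ = begin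
  (a + (2 + b)) * 2              ≤⟨ ℕ.m≤m+n _ (a * b) ⟩
  (a + (2 + b)) * 2 + a * b      ≡⟨ solve 2 (λ a b → (a :+ (con 2 :+ b)) :* con 2 :+ a :* b := con 1 :* ((con 2 :+ a) :* (con 2 :+ b))) refl a b ⟩
  1 * ((2 + a) * (2 + b))        ∎
  where
  open ℕ.≤-Reasoning
  open +-*-Solver

-- The extreme value 4/9 belongs to eccentricities 3 and 3. After shifting both by 3, the excess of
-- the right side is the polynomial added in the first step, whose coefficients are nonnegative.
strict-bound : ∀ {a b} → 3 ≤ a → 3 ≤ b → (a + b ∸ 2) * 9 ≤ 4 * (a * b)
strict-bound {suc (suc (suc a))} {suc (suc (suc b))} _ _ = begin
  (suc a + (3 + b)) * 9                               ≤⟨ ℕ.m≤m+n _ (3 * a + 3 * b + 4 * (a * b)) ⟩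
  (suc a + (3 + b)) * 9 + (3 * a + 3 * b + 4 * (a * b)) ≡⟨ solve 2 (λ a b → (con 1 :+ a :+ (con 3 :+ b)) :* con 9 :+ (con 3 :* a :+ con 3 :* b :+ con 4 :* (a :* b)) := con 4 :* ((con 3 :+ a) :* (con 3 :+ b))) refl a b ⟩
  4 * ((3 + a) * (3 + b))                             ∎
  where
  open ℕ.≤-Reasoning
  open +-*-Solver
strict-bound {suc (suc (suc _))} {suc zero} _ (s≤s ())
strict-bound {suc (suc (suc _))} {suc (suc zero)} _ (s≤s (s≤s ()))
strict-bound {suc zero} (s≤s ())
strict-bound {suc (suc zero)} (s≤s (s≤s ()))

-- The inequality amounts to (a - 2)(b - 2) ≤ 0, which fails for the pair (1, 1): its term is 0.
tight-bound : ∀ {a b} → 1 ≤ a → 1 ≤ b → (a ≤ 1 → b ≤ 1 → ⊥) → a ≤ 2 ⊎ b ≤ 2 → 1 * (a * b) ≤ (a + b ∸ 2) * 2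
tight-bound {1} {1} _ _ h _ = ⊥-elim (h ℕ.≤-refl ℕ.≤-refl)
tight-bound {1} {suc (suc b)} _ _ _ _ = begin
  1 * (1 * (2 + b))  ≡⟨ solve 1 (λ b → con 1 :* (con 1 :* (con 2 :+ b)) := con 2 :+ b) refl b ⟩
  2 + b              ≤⟨ ℕ.m≤m+n _ b ⟩
  2 + b + b          ≡⟨ solve 1 (λ b → con 2 :+ b :+ b := (con 1 :+ b) :* con 2) refl b ⟩
  (1 + b) * 2        ∎
  where
  open ℕ.≤-Reasoning
  open +-*-Solver
tight-bound {2} {b} _ _ _ _ = ℕ.≤-reflexive (solve 1 (λ b → con 1 :* (con 2 :* b) := b :* con 2) refl b)
  where open +-*-Solver
tight-bound {suc (suc (suc a))} _ _ _ (inj₁ (s≤s (s≤s ())))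
tight-bound {suc (suc (suc a))} {1} _ _ _ _ = begin
  1 * ((3 + a) * 1)            ≡⟨ solve 1 (λ a → con 1 :* ((con 3 :+ a) :* con 1) := con 3 :+ a) refl a ⟩
  3 + a                        ≤⟨ ℕ.m≤m+n _ (1 + a) ⟩
  3 + a + (1 + a)              ≡⟨ solve 1 (λ a → con 3 :+ a :+ (con 1 :+ a) := (con 1 :+ a :+ con 1) :* con 2) refl a ⟩
  (1 + a + 1) * 2              ∎
  where
  open ℕ.≤-Reasoning
  open +-*-Solver
tight-bound {suc (suc (suc a))} {2} _ _ _ _ = ℕ.≤-reflexive (solve 1 (λ a → con 1 :* ((con 3 :+ a) :* con 2) := (con 1 :+ a :+ con 2) :* con 2) refl a)
  where open +-*-Solver
tight-bound {suc (suc (suc a))} {suc (suc (suc b))} _ _ _ (inj₂ (s≤s (s≤s ())))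

-- Reachability, distance and eccentricity; the edges as a list

T⇒≡ : ∀ {b} → T b → b ≡ true
T⇒≡ = to T-≡

≡⇒T : ∀ {b} → b ≡ true → T b
≡⇒T = from T-≡

false≢true : false ≢ true
false≢true ()

≢true⇒≡false : ∀ {b} → b ≢ true → b ≡ false
≢true⇒≡false {true}  h = ⊥-elim (h refl)
≢true⇒≡false {false} h = refl

-- `dist` is defined by an auxiliary function that is out of scope here: the definition of
-- `search` is inferred by unification from a goal in which that function is applied to
-- distinct variables.
mutual
  search : ∀ {n} → Graph n → Fin n → Fin n → ℕ → ℕ → ℕ
  search G u v f k = _

  dist-search : ∀ {n} (G : Graph (suc n)) u v → reach G 0 u v ≡ false → dist G u v ≡ search G u v n 1
  dist-search {n} G u v eq rewrite eq with suc n | G | u | v | 1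
  ... | _ | _ | _ | _ | _ = refl

foldr-⊔-upper : ∀ {x xs} → x ∈ xs → x ≤ foldr _⊔_ 0 xs
foldr-⊔-upper (here refl) = ℕ.m≤m⊔n _ _
foldr-⊔-upper (there x∈xs) = ℕ.≤-trans (foldr-⊔-upper x∈xs) (ℕ.m≤n⊔m _ _)

foldr-⊔-least : ∀ {k} xs → (∀ {x} → x ∈ xs → x ≤ k) → foldr _⊔_ 0 xs ≤ k
foldr-⊔-least []       h = z≤n
foldr-⊔-least (x ∷ xs) h = ℕ.⊔-lub (h (here refl)) (foldr-⊔-least xs λ x∈xs → h (there x∈xs))

module _ {n} (G : Graph n) where

  Adj : Fin n → Fin n → Set
  Adj u v = G u v ≡ true

  reach-zero⁻ : ∀ {u v} → reach G 0 u v ≡ true → u ≡ v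
  reach-zero⁻ r = toWitness (≡⇒T r)

  reach-zero⁺ : ∀ u → reach G 0 u u ≡ true
  reach-zero⁺ u = T⇒≡ (fromWitness {a? = u Fin.≟ u} refl)

  reach-suc⁻ : ∀ k {u v} → reach G (suc k) u v ≡ true →
               reach G k u v ≡ true ⊎ ∃ λ w → reach G k u w ≡ true × Adj w v
  reach-suc⁻ k {u} {v} r with to T-∨ (≡⇒T r)
  ... | inj₁ t = inj₁ (T⇒≡ t)
  ... | inj₂ t with w , _ , tw ← find (any⁻ _ (allFin n) t) =
    inj₂ (w , T⇒≡ (proj₁ (to T-∧ tw)) , T⇒≡ (proj₂ (to (T-∧ {reach G k u w}) tw)))

  reach-weaken : ∀ k {u v} → reach G k u v ≡ true → reach G (suc k) u v ≡ true
  reach-weaken k r = T⇒≡ (from T-∨ (inj₁ (≡⇒T r)))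

  reach-step : ∀ k {u w v} → reach G k u w ≡ true → Adj w v → reach G (suc k) u v ≡ true
  reach-step k {u} {w} {v} r a = T⇒≡ (from (T-∨ {reach G k u v}) (inj₂ (any⁺ _ (lose (∈-allFin w) (from T-∧ (≡⇒T r , ≡⇒T a))))))

  reach-mono : ∀ {k l u v} → k ≤ l → reach G k u v ≡ true → reach G l u v ≡ true
  reach-mono k≤l = go (ℕ.≤⇒≤′ k≤l)
    where
    go : ∀ {k l u v} → k ℕ.≤′ l → reach G k u v ≡ true → reach G l u v ≡ true
    go ℕ.≤′-refl r = r
    go (ℕ.≤′-step {l} k≤l) r = reach-weaken l (go k≤l r)

  -- When its fuel runs out, `search` returns j + f without having tested that level. Only a result
  -- below this default is a genuine hit.
  search≤⇒reach : ∀ {u v k} f j → k < j + f → search G u v f j ≤ k → reach G k u v ≡ true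
  search≤⇒reach {k = k} zero j k<j j≤k = ⊥-elim (ℕ.<⇒≱ k<j (subst (_≤ k) (sym (ℕ.+-identityʳ j)) j≤k))
  search≤⇒reach {u} {v} {k} (suc f) j k<j+f s≤k with reach G j u v in eq
  ... | true  = reach-mono s≤k eq
  ... | false = search≤⇒reach f (suc j) (subst (k <_) (ℕ.+-suc j f) k<j+f) s≤k

  reach⇒search≤ : ∀ {u v k} f j → j ≤ k → reach G k u v ≡ true → search G u v f j ≤ k
  reach⇒search≤ zero j j≤k r = j≤k
  reach⇒search≤ {u} {v} {k} (suc f) j j≤k r with reach G j u v in eq
  ... | true  = j≤k
  ... | false = reach⇒search≤ f (suc j) (ℕ.≤∧≢⇒< j≤k λ { refl → false≢true (trans (sym eq) r) }) r

  ecc≤⇒reach : ∀ {u k} → k < n → ecc G u ≤ k → ∀ v → reach G k u v ≡ true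
  ecc≤⇒reach {u} k<n e≤k v = search≤⇒reach n 0 k<n
    (ℕ.≤-trans (foldr-⊔-upper (∈-map⁺ (dist G u) (∈-allFin v))) e≤k)

  reach⇒ecc≤ : ∀ {u k} → (∀ v → reach G k u v ≡ true) → ecc G u ≤ k
  reach⇒ecc≤ {u} {k} h = foldr-⊔-least (map (dist G u) (allFin n)) λ d∈ → bound (∈-map⁻ (dist G u) d∈)
    where
    bound : ∀ {d} → (∃ λ v → v ∈ allFin n × d ≡ dist G u v) → d ≤ k
    bound (v , _ , refl) = reach⇒search≤ n 0 z≤n (h v)

  Near : Fin n → Fin n → Set
  Near u v = u ≡ v ⊎ Adj u v ⊎ ∃ λ w → Adj u w × Adj w v

  -- Stands for eccentricity at most 2.
  Central : Fin n → Set
  Central u = ∀ w → Near u w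

  -- The equality case of the bound, put in a form that an isomorphism preserves by mapping
  -- adjacencies.
  Dominated : Set
  Dominated = ∀ {u v} → Adj u v → Central u ⊎ Central v

  reach₁⁻ : ∀ {u v} → reach G 1 u v ≡ true → u ≡ v ⊎ Adj u v
  reach₁⁻ r with reach-suc⁻ 0 r
  ... | inj₁ r₀ = inj₁ (reach-zero⁻ r₀)
  ... | inj₂ (w , r₀ , a) with refl ← reach-zero⁻ r₀ = inj₂ a

  reach₂⁻ : ∀ {u v} → reach G 2 u v ≡ true → Near u v
  reach₂⁻ r with reach-suc⁻ 1 r
  ... | inj₁ r₁ = Sum.map₂ inj₁ (reach₁⁻ r₁)
  ... | inj₂ (w , r₁ , a) with reach₁⁻ r₁
  ...   | inj₁ refl = inj₂ (inj₁ a)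
  ...   | inj₂ b = inj₂ (inj₂ (w , b , a))

  reach₂⁺ : ∀ {u v} → Near u v → reach G 2 u v ≡ true
  reach₂⁺ {u} (inj₁ refl) = reach-mono {0} {2} z≤n (reach-zero⁺ u)
  reach₂⁺ {u} (inj₂ (inj₁ a)) = reach-mono {1} {2} (s≤s z≤n) (reach-step 0 (reach-zero⁺ u) a)
  reach₂⁺ {u} (inj₂ (inj₂ (w , a , b))) = reach-step 1 (reach-step 0 (reach-zero⁺ u) a) b

  isEdge : Fin n × Fin n → Bool
  isEdge (u , v) = (toℕ u <ᵇ toℕ v) ∧ G u v

  isEdge? : ∀ e → Dec (T (isEdge e))
  isEdge? e = T? (isEdge e)

  edges : List (Fin n × Fin n)
  edges = filter isEdge? (cartesianProduct (allFin n) (allFin n))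

  term : Fin n × Fin n → ℕ × ℕ
  term (u , v) = ecc G u + ecc G v ∸ 2 , ecc G u * ecc G v

  abc3Terms-edges : abc3Terms G ≡ map term edges
  abc3Terms-edges = outer (allFin n)
    where
    row : Fin n → Fin n → List (ℕ × ℕ)
    row u v = if isEdge (u , v) then term (u , v) ∷ [] else []
    inner : ∀ u ys → concatMap (row u) ys ≡ map term (filter isEdge? (map (u ,_) ys))
    inner u [] = refl
    inner u (y ∷ ys) with isEdge (u , y)
    ... | true  = cong (term (u , y) ∷_) (inner u ys)
    ... | false = inner u ys
    outer : ∀ xs → concatMap (λ u → concatMap (row u) (allFin n)) xs ≡ map term (filter isEdge? (cartesianProduct xs (allFin n)))
    outer [] = refl
    outer (x ∷ xs) = begin
      concatMap (row x) (allFin n) ++ concatMap (λ u → concatMap (row u) (allFin n)) xs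
        ≡⟨ cong₂ _++_ (inner x (allFin n)) (outer xs) ⟩
      map term (filter isEdge? (map (x ,_) (allFin n))) ++ map term (filter isEdge? (cartesianProduct xs (allFin n)))
        ≡⟨ map-++ term (filter isEdge? (map (x ,_) (allFin n))) _ ⟨
      map term (filter isEdge? (map (x ,_) (allFin n)) ++ filter isEdge? (cartesianProduct xs (allFin n)))
        ≡⟨ cong (map term) (filter-++ isEdge? (map (x ,_) (allFin n)) _) ⟨
      map term (filter isEdge? (cartesianProduct (x ∷ xs) (allFin n))) ∎
      where open ≡-Reasoning

-- Repetition-free lists, cyclic pairs and loop erasure

Unique∧⊆⇒length≤ : ∀ {A : Set} {xs ys : List A} → Unique xs → (∀ {x} → x ∈ xs → x ∈ ys) → length xs ≤ length ys
Unique∧⊆⇒length≤ [] _ = z≤n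
Unique∧⊆⇒length≤ {xs = x ∷ xs} (x∉ ∷ u) sub with as , bs , refl ← ∈-∃++ (sub (here refl)) =
  subst (suc (length xs) ≤_) (sym (length-++-sucʳ as x bs)) (s≤s (Unique∧⊆⇒length≤ u λ y∈xs → skip y∈xs (∈-++⁻ as (sub (there y∈xs)))))
  where
  skip : ∀ {y} → y ∈ xs → y ∈ as ⊎ y ∈ x ∷ bs → y ∈ as ++ bs
  skip y∈xs (inj₁ y∈as) = ∈-++⁺ˡ y∈as
  skip y∈xs (inj₂ (here refl)) = ⊥-elim (All.lookup x∉ y∈xs refl)
  skip y∈xs (inj₂ (there y∈bs)) = ∈-++⁺ʳ as y∈bs

module _ {A : Set} where

  -- The consecutive pairs of x ∷ xs ++ [ w ], so that cpairs (x ∷ xs) is chain x xs x.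
  chain : A → List A → A → List (A × A)
  chain x xs w = zip (x ∷ xs) (xs ++ w ∷ [])

  chain-successor : ∀ {x xs w v} → v ∈ x ∷ xs → ∃ λ u → (v , u) ∈ chain x xs w
  chain-successor {xs = []}     (here refl) = _ , here refl
  chain-successor {xs = y ∷ ys} (here refl) = y , here refl
  chain-successor {xs = y ∷ ys} (there v∈) with u , p ← chain-successor v∈ = u , there p

  chain-∈₁ : ∀ {x xs w a b} → (a , b) ∈ chain x xs w → a ∈ x ∷ xs
  chain-∈₁ {xs = []}     (here refl) = here refl
  chain-∈₁ {xs = y ∷ ys} (here refl) = here refl
  chain-∈₁ {xs = y ∷ ys} (there p)   = there (chain-∈₁ p)

  chain-∈₂ : ∀ {x xs w a b} → (a , b) ∈ chain x xs w → b ∈ xs ⊎ b ≡ w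
  chain-∈₂ {xs = []}     (here refl) = inj₂ refl
  chain-∈₂ {xs = y ∷ ys} (here refl) = inj₁ (here refl)
  chain-∈₂ {xs = y ∷ ys} (there p) with chain-∈₂ p
  ... | inj₁ b∈ = inj₁ (there b∈)
  ... | inj₂ eq = inj₂ eq

  chain-functional : ∀ {x xs w a b c} → Unique (x ∷ xs) → (a , b) ∈ chain x xs w → (a , c) ∈ chain x xs w → b ≡ c
  chain-functional {xs = []}     _ (here refl) (here refl) = refl
  chain-functional {xs = y ∷ ys} _ (here refl) (here refl) = refl
  chain-functional {xs = y ∷ ys} (x∉ ∷ _) (here refl) (there q) = ⊥-elim (All.lookup x∉ (chain-∈₁ q) refl)
  chain-functional {xs = y ∷ ys} (x∉ ∷ _) (there p) (here refl) = ⊥-elim (All.lookup x∉ (chain-∈₁ p) refl)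
  chain-functional {xs = y ∷ ys} (_ ∷ u) (there p) (there q) = chain-functional u p q

  chain-asym : ∀ {x xs w a b} → Unique (x ∷ xs) → w ∉ x ∷ xs → (a , b) ∈ chain x xs w → (b , a) ∈ chain x xs w → ⊥
  chain-asym {xs = []} _ w∉ (here refl) (here refl) = w∉ (here refl)
  chain-asym {xs = y ∷ ys} (x∉ ∷ _) w∉ (here refl) q with chain-∈₂ q
  ... | inj₁ x∈ = All.lookup x∉ x∈ refl
  ... | inj₂ refl = w∉ (here refl)
  chain-asym {xs = y ∷ ys} (x∉ ∷ _) w∉ p@(there _) (here refl) with chain-∈₂ p
  ... | inj₁ x∈ = All.lookup x∉ x∈ refl
  ... | inj₂ refl = w∉ (here refl)
  chain-asym {xs = y ∷ ys} (_ ∷ u) w∉ (there p) (there q) = chain-asym u (λ w∈ → w∉ (there w∈)) p q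

  -- Without the first pair (x , y), what remains is the chain from y ending at x, and x is not
  -- among its starting points, so `chain-asym` applies. The first pair itself is never reversed,
  -- because the successor of y is a third vertex z.
  cpairs-asym : ∀ {vs : List A} {a b} → 3 ≤ length vs → Unique vs → (a , b) ∈ cpairs vs → (b , a) ∈ cpairs vs → ⊥
  cpairs-asym {x ∷ []} (s≤s ())
  cpairs-asym {x ∷ y ∷ []} (s≤s (s≤s ()))
  cpairs-asym {x ∷ y ∷ z ∷ zs} _ u@(x∉ ∷ _) (here refl) (here refl) = All.lookup x∉ (here refl) refl
  cpairs-asym {x ∷ y ∷ z ∷ zs} _ ((_ ∷ x≢z ∷ _) ∷ _) (here refl) (there (here refl)) = x≢z refl
  cpairs-asym {x ∷ y ∷ z ∷ zs} _ (_ ∷ (y∉ ∷ _)) (here refl) (there (there q)) = All.lookup y∉ (chain-∈₁ q) refl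
  cpairs-asym {x ∷ y ∷ z ∷ zs} _ ((_ ∷ x≢z ∷ _) ∷ _) (there (here refl)) (here refl) = x≢z refl
  cpairs-asym {x ∷ y ∷ z ∷ zs} _ (_ ∷ (y∉ ∷ _)) (there (there p)) (here refl) = All.lookup y∉ (chain-∈₁ p) refl
  cpairs-asym {x ∷ y ∷ z ∷ zs} _ (x∉ ∷ u) (there p) (there q) = chain-asym u (λ x∈ → All.lookup x∉ x∈ refl) p q

  chain-Star : ∀ {R : A → A → Set} {x xs w} → (∀ {a b} → (a , b) ∈ chain x xs w → R a b) → ∀ {v} → v ∈ x ∷ xs → Star R x v
  chain-Star R! (here refl) = ε
  chain-Star {xs = y ∷ ys} R! (there v∈) = R! (here refl) ◅ chain-Star (λ p → R! (there p)) v∈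

data Path {A : Set} (R : A → A → Set) : A → List A → A → Set where
  stop : ∀ {x} → Path R x [] x
  step : ∀ {x y ys z} → R x y → Path R y ys z → Path R x (y ∷ ys) z

module _ {A : Set} {R : A → A → Set} where

  suffix : ∀ {x ys z w} → Path R x ys z → Unique (x ∷ ys) → w ∈ x ∷ ys → ∃ λ ys′ → Path R w ys′ z × Unique (w ∷ ys′)
  suffix p u (here refl) = _ , p , u
  suffix (step _ p) (_ ∷ u) (there w∈) = suffix p u w∈

  -- If the start reappears on the erased remainder, the loop up to that occurrence is dropped.
  loop-erase : (∀ x (xs : List A) → Dec (x ∈ xs)) → ∀ {x z} → Star R x z → ∃ λ ys → Path R x ys z × Unique (x ∷ ys)
  loop-erase _∈?_ ε = [] , stop , [] ∷ []
  loop-erase _∈?_ {x} (r ◅ rs) with ys , p , u ← loop-erase _∈?_ rs with x ∈? (_ ∷ ys)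
  ... | yes x∈ = suffix p u x∈
  ... | no x∉ = _ , step r p , All.tabulate (λ { y∈ refl → x∉ y∈ }) ∷ u

  Path-chain : ∀ {S : A × A → Set} {x ys z w} → Path R x ys z → (∀ {a b} → R a b → S (a , b)) → S (z , w) → All S (chain x ys w)
  Path-chain stop _ s = s ∷ []
  Path-chain (step r p) R⊆S s = R⊆S r ∷ Path-chain p R⊆S s

  Path-last : ∀ {x ys z w} → Path R x ys z → (z , w) ∈ chain x ys w
  Path-last stop = here refl
  Path-last (step _ p) = there (Path-last p)

SameEdge : ∀ {A : Set} → A → A → A → A → Set
SameEdge x y u v = (x ≡ u × y ≡ v) ⊎ (x ≡ v × y ≡ u)

SameEdge-flip : ∀ {A : Set} {x y u v : A} → SameEdge x y u v → SameEdge y x u v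
SameEdge-flip (inj₁ (p , q)) = inj₂ (q , p)
SameEdge-flip (inj₂ (p , q)) = inj₁ (q , p)

sorted : ∀ {n} → Fin n → Fin n → Fin n × Fin n
sorted a b with toℕ a ℕ.<? toℕ b
... | yes _ = a , b
... | no _  = b , a

sorted-SameEdge : ∀ {n} (a b : Fin n) {u v} → sorted a b ≡ (u , v) → SameEdge a b u v
sorted-SameEdge a b eq with toℕ a ℕ.<? toℕ b
sorted-SameEdge a b refl | yes _ = inj₁ (refl , refl)
sorted-SameEdge a b refl | no _  = inj₂ (refl , refl)

sorted-≡ : ∀ {n} {a b u v : Fin n} → toℕ u < toℕ v → SameEdge a b u v → sorted a b ≡ (u , v)
sorted-≡ {a = a} {b} u<v same with toℕ a ℕ.<? toℕ b | same
... | yes _   | inj₁ (refl , refl) = refl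
... | yes a<b | inj₂ (refl , refl) = ⊥-elim (ℕ.<-asym a<b u<v)
... | no ¬a<b | inj₁ (refl , refl) = ⊥-elim (¬a<b u<v)
... | no _    | inj₂ (refl , refl) = refl

_∈?_ : ∀ {n} (x : Fin n) xs → Dec (x ∈ xs)
_∈?_ = _∈?′_
  where open import Data.List.Membership.DecPropositional Fin._≟_ using () renaming (_∈?_ to _∈?′_)

-- A unicyclic graph of order n has n edges

module _ {n} (G : Graph n) (simple : IsSimple G) where

  Adj-sym : ∀ {u v} → Adj G u v → Adj G v u
  Adj-sym {u} {v} a = trans (proj₁ simple v u) a

  Adj-≢ : ∀ {u v} → Adj G u v → u ≢ v
  Adj-≢ {u} a refl = false≢true (trans (sym (proj₂ simple u)) a)

  ∈-edges⁺ : ∀ {u v} → toℕ u < toℕ v → Adj G u v → (u , v) ∈ edges G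
  ∈-edges⁺ u<v a = ∈-filter⁺ (isEdge? G) (∈-cartesianProduct⁺ (∈-allFin _) (∈-allFin _))
    (from T-∧ (ℕ.<⇒<ᵇ u<v , ≡⇒T a))

  ∈-edges⁻ : ∀ {u v} → (u , v) ∈ edges G → toℕ u < toℕ v × Adj G u v
  ∈-edges⁻ {u} {v} e with lt , a ← to T-∧ (proj₂ (∈-filter⁻ (isEdge? G) {xs = cartesianProduct (allFin n) (allFin n)} e)) =
    ℕ.<ᵇ⇒< (toℕ u) (toℕ v) lt , T⇒≡ a

  edges-unique : Unique (edges G)
  edges-unique = Unique.filter⁺ (isEdge? G) (Unique.cartesianProduct⁺ (Unique.allFin⁺ n) (Unique.allFin⁺ n))

  sorted-∈-edges : ∀ {a b} → Adj G a b → sorted a b ∈ edges G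
  sorted-∈-edges {a} {b} adj with toℕ a ℕ.<? toℕ b
  ... | yes a<b = ∈-edges⁺ a<b adj
  ... | no a≮b = ∈-edges⁺ (ℕ.≤∧≢⇒< (ℕ.≮⇒≥ a≮b) (λ eq → Adj-≢ adj (sym (Fin.toℕ-injective eq)))) (Adj-sym adj)

  -- After loop erasure the path is neither empty nor the edge uv itself. It thus has at least two
  -- edges, and uv closes it to a cycle.
  bypass⇒cycle : ∀ {u v} → Adj G u v → Star (λ x y → Adj G x y × ¬ SameEdge x y u v) u v →
                 ∃ λ ws → IsCycle G ws × CycEdge ws u v
  bypass⇒cycle {u} {v} a walk with loop-erase _∈?_ walk
  ... | .[] , stop , _ = ⊥-elim (Adj-≢ a refl)
  ... | .(v ∷ []) , step (_ , ¬same) stop , _ = ⊥-elim (¬same (inj₁ (refl , refl)))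
  ... | ys , p@(step _ (step _ _)) , unique =
    u ∷ ys , (s≤s (s≤s (s≤s z≤n)) , unique , Path-chain p proj₁ (Adj-sym a)) , inj₂ (Path-last p)

  module _ (connected : Connected G) {r : Fin n} {rs : List (Fin n)} (cycle : IsCycle G (r ∷ rs)) where

    -- Cycle vertices point to their successor, the others one step towards r; each vertex
    -- then owns exactly one edge.
    Parent : Fin n → Fin n → Set
    Parent v w = (v , w) ∈ cpairs (r ∷ rs)
      ⊎ (v ∉ r ∷ rs × Adj G v w × ∃ λ k → reach G k r w ≡ true × reach G k r v ≡ false)

    -- Descends to the level at which v is first reached; the last vertex before v on such a walk
    -- was already reached one level earlier.
    closer : ∀ {v} k → v ≢ r → reach G k r v ≡ true → ∃ λ w → Adj G v w × ∃ λ k → reach G k r w ≡ true × reach G k r v ≡ false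
    closer zero    v≢r h = ⊥-elim (v≢r (sym (reach-zero⁻ G h)))
    closer {v} (suc k) v≢r h with reach-suc⁻ G k h
    ... | inj₁ h′ = closer k v≢r h′
    ... | inj₂ (w , rw , a) with reach G k r v in eq
    ...   | true  = closer k v≢r eq
    ...   | false = w , Adj-sym a , k , rw , eq

    parent : ∀ v → ∃ (Parent v)
    parent v with v ∈? (r ∷ rs)
    ... | yes v∈ with w , p ← chain-successor v∈ = w , inj₁ p
    ... | no v∉ with k , h ← connected r v with w , q ← closer k (λ { refl → v∉ (here refl) }) h = w , inj₂ (v∉ , q)

    cycle-Adj : ∀ {a b} → (a , b) ∈ cpairs (r ∷ rs) → Adj G a b
    cycle-Adj = All.lookup (proj₂ (proj₂ cycle))

    Parent-Adj : ∀ {v w} → Parent v w → Adj G v w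
    Parent-Adj (inj₁ p) = cycle-Adj p
    Parent-Adj (inj₂ (_ , a , _)) = a

    -- On the cycle this is `cpairs-asym`. In the mixed case the successor lies on the cycle, while
    -- the other rule applies only off it. Off the cycle, the levels k and l are comparable, and a
    -- vertex reached at the smaller one stays reached at the larger.
    Parent-asym : ∀ {v w} → Parent v w → Parent w v → ⊥
    Parent-asym (inj₁ p) (inj₁ q) = cpairs-asym (proj₁ cycle) (proj₁ (proj₂ cycle)) p q
    Parent-asym (inj₁ p) (inj₂ (w∉ , _)) with chain-∈₂ p
    ... | inj₁ w∈ = w∉ (there w∈)
    ... | inj₂ refl = w∉ (here refl)
    Parent-asym (inj₂ (v∉ , _)) (inj₁ q) with chain-∈₂ q
    ... | inj₁ v∈ = v∉ (there v∈)
    ... | inj₂ refl = v∉ (here refl)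
    Parent-asym (inj₂ (_ , _ , k , kw , kv)) (inj₂ (_ , _ , l , lv , lw)) with ℕ.≤-total k l
    ... | inj₁ k≤l = false≢true (trans (sym lw) (reach-mono G k≤l kw))
    ... | inj₂ l≤k = false≢true (trans (sym kv) (reach-mono G l≤k lv))

    edgeOf : Fin n → Fin n × Fin n
    edgeOf v = sorted v (proj₁ (parent v))

    -- Two different owners of one edge would be parents of each other.
    edgeOf-injective : ∀ {v w} → edgeOf v ≡ edgeOf w → v ≡ w
    edgeOf-injective {v} {w} eq
      with sorted-SameEdge v _ refl | sorted-SameEdge w _ (sym eq)
    ... | inj₁ (v≡ , _)  | inj₁ (w≡ , _)  = trans v≡ (sym w≡)
    ... | inj₂ (v≡ , _)  | inj₂ (w≡ , _)  = trans v≡ (sym w≡)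
    ... | inj₁ (v≡ , pv) | inj₂ (w≡ , pw) = ⊥-elim (Parent-asym
          (subst (Parent v) (trans pv (sym w≡)) (proj₂ (parent v)))
          (subst (Parent w) (trans pw (sym v≡)) (proj₂ (parent w))))
    ... | inj₂ (v≡ , pv) | inj₁ (w≡ , pw) = ⊥-elim (Parent-asym
          (subst (Parent v) (trans pv (sym w≡)) (proj₂ (parent v)))
          (subst (Parent w) (trans pw (sym v≡)) (proj₂ (parent w))))

    length-edgeOf : length (map edgeOf (allFin n)) ≡ n
    length-edgeOf = trans (length-map edgeOf (allFin n)) (length-tabulate {n = n} (λ i → i))

    n≤length-edges : n ≤ length (edges G)
    n≤length-edges = subst (_≤ length (edges G)) length-edgeOf
      (Unique∧⊆⇒length≤ (Unique.map⁺ edgeOf-injective (Unique.allFin⁺ n)) λ e∈ → member (∈-map⁻ edgeOf e∈))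
      where
      member : ∀ {e} → (∃ λ v → v ∈ allFin n × e ≡ edgeOf v) → e ∈ edges G
      member (v , _ , refl) = sorted-∈-edges (Parent-Adj (proj₂ (parent v)))

    cpairs-parent : ∀ {a b} → (a , b) ∈ cpairs (r ∷ rs) → b ≡ proj₁ (parent a)
    cpairs-parent {a} p with parent a
    ... | w , inj₁ q = chain-functional (proj₁ (proj₂ cycle)) p q
    ... | w , inj₂ (a∉ , _) = ⊥-elim (a∉ (chain-∈₁ p))

    module _ (unique : ∀ ws → IsCycle G ws → ∀ a b → CycEdge (r ∷ rs) a b ⇔ CycEdge ws a b) where

      -- If nobody owns uv, the parent edges lead from u and from v to r without using uv. This
      -- bypass puts uv on a cycle, hence on the given one; but every edge of the given cycle is
      -- owned.
      edges⊆edgeOf : ∀ {u v} → toℕ u < toℕ v → Adj G u v → (u , v) ∈ map edgeOf (allFin n)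
      edges⊆edgeOf {u} {v} u<v adj with (u , v) ∈ₑ? map edgeOf (allFin n)
        where open import Data.List.Membership.DecPropositional (≡-dec (Fin._≟_ {n}) (Fin._≟_ {n})) renaming (_∈?_ to _∈ₑ?_)
      ... | yes e∈ = e∈
      ... | no e∉ = ⊥-elim absurd
        where
        R : Fin n → Fin n → Set
        R x y = Adj G x y × ¬ SameEdge x y u v
        R-sym : ∀ {x y} → R x y → R y x
        R-sym (a , ¬s) = Adj-sym a , λ s → ¬s (SameEdge-flip s)
        ¬own : ∀ x → ¬ SameEdge x (proj₁ (parent x)) u v
        ¬own x s = e∉ (subst (_∈ map edgeOf (allFin n)) (sorted-≡ u<v s) (∈-map⁺ edgeOf (∈-allFin x)))
        R-parent : ∀ x → R x (proj₁ (parent x))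
        R-parent x = Parent-Adj (proj₂ (parent x)) , ¬own x
        R-cycle : ∀ {a b} → (a , b) ∈ cpairs (r ∷ rs) → R a b
        R-cycle {a} p with refl ← cpairs-parent p = R-parent a
        toRoot : ∀ k {x} → reach G k r x ≡ true → Star R x r
        toRoot zero h with refl ← reach-zero⁻ G h = ε
        toRoot (suc k) {x} h with x ∈? (r ∷ rs)
        ... | yes x∈ = reverse R-sym (chain-Star R-cycle x∈)
        ... | no x∉ with parent x | R-parent x
        ...   | w , inj₁ p | _ = ⊥-elim (x∉ (chain-∈₁ p))
        ...   | w , inj₂ (_ , _ , l , lw , lx) | s = s ◅ toRoot k (reach-mono G l≤k lw)
          where
          -- x is reached at level suc k but not at level l. So the parent is reached within k
          -- steps, and the recursion on the level goes through.
          l≤k : l ≤ k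
          l≤k = ℕ.≮⇒≥ λ k<l → false≢true (trans (sym lx) (reach-mono G k<l h))
        root : ∀ x → Star R x r
        root x = toRoot (proj₁ (connected r x)) (proj₂ (connected r x))
        ¬cycEdge : ¬ CycEdge (r ∷ rs) u v
        ¬cycEdge (inj₁ p) = proj₂ (R-cycle p) (inj₁ (refl , refl))
        ¬cycEdge (inj₂ p) = proj₂ (R-cycle p) (inj₂ (refl , refl))
        absurd : ⊥
        absurd with ws , c , e ← bypass⇒cycle adj (root u ◅◅ reverse R-sym (root v)) =
          ¬cycEdge (from (unique ws c u v) e)

      length-edges : length (edges G) ≡ n
      length-edges = ℕ.≤-antisym
        (subst (length (edges G) ≤_) length-edgeOf
          (Unique∧⊆⇒length≤ edges-unique λ e∈ → edges⊆edgeOf (proj₁ (∈-edges⁻ e∈)) (proj₂ (∈-edges⁻ e∈))))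
        n≤length-edges

-- Isomorphism with `H` from an enumeration of the vertices

<⇒<ᵇ≡true : ∀ {a b} → a < b → (a <ᵇ b) ≡ true
<⇒<ᵇ≡true a<b = T⇒≡ (ℕ.<⇒<ᵇ a<b)

≥⇒<ᵇ≡false : ∀ {a b} → b ≤ a → (a <ᵇ b) ≡ false
≥⇒<ᵇ≡false {a} {b} b≤a = ≢true⇒≡false λ eq → ℕ.<⇒≱ (ℕ.<ᵇ⇒< a b (≡⇒T eq)) b≤a

-- Positions are natural numbers to match the numbering in `Hadj`. As a relation, it lets a case
-- split on the position also determine the entry.
data At {A : Set} : List A → ℕ → A → Set where
  here  : ∀ {x xs} → At (x ∷ xs) 0 x
  there : ∀ {x xs i y} → At xs i y → At (x ∷ xs) (suc i) y

module _ {A : Set} where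

  At⇒∈ : ∀ {xs : List A} {i x} → At xs i x → x ∈ xs
  At⇒∈ here = here refl
  At⇒∈ (there p) = there (At⇒∈ p)

  At⇒< : ∀ {xs : List A} {i x} → At xs i x → i < length xs
  At⇒< here = s≤s z≤n
  At⇒< (there p) = s≤s (At⇒< p)

  At-lookup : ∀ (xs : List A) i → At xs (toℕ i) (lookup xs i)
  At-lookup (x ∷ xs) zero = here
  At-lookup (x ∷ xs) (suc i) = there (At-lookup xs i)

  At-index : ∀ {xs : List A} {x} (p : x ∈ xs) → At xs (toℕ (index p)) x
  At-index (here refl) = here
  At-index (there p) = there (At-index p)

  At-functional : ∀ {xs : List A} {i x y} → At xs i x → At xs i y → x ≡ y
  At-functional here here = refl
  At-functional (there p) (there q) = At-functional p q

  At-injective : ∀ {xs : List A} {i j x} → Unique xs → At xs i x → At xs j x → i ≡ j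
  At-injective _ here here = refl
  At-injective (x∉ ∷ _) here (there q) = ⊥-elim (All.lookup x∉ (At⇒∈ q) refl)
  At-injective (x∉ ∷ _) (there p) here = ⊥-elim (All.lookup x∉ (At⇒∈ p) refl)
  At-injective (_ ∷ u) (there p) (there q) = cong suc (At-injective u p q)

  At-++ : ∀ (xs : List A) {ys i x} → At (xs ++ ys) i x → At xs i x ⊎ (length xs ≤ i × At ys (i ∸ length xs) x)
  At-++ [] p = inj₂ (z≤n , p)
  At-++ (x ∷ xs) here = inj₁ here
  At-++ (x ∷ xs) (there p) with At-++ xs p
  ... | inj₁ q = inj₁ (there q)
  ... | inj₂ (l , q) = inj₂ (s≤s l , q)

  -- Connects the arithmetic of `block` with lists: `t <ᵇ m` asks whether position t falls into the
  -- first list, and `t ∸ m` is the position once that list is dropped.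
  At-concat : ∀ (xss : List (List A)) {t x} → At (concat xss) t x → ∃ λ B → At xss (block (map length xss) t) B × x ∈ B
  At-concat (xs ∷ xss) {t} p with At-++ xs p
  ... | inj₁ q rewrite <⇒<ᵇ≡true (At⇒< q) = xs , here , At⇒∈ q
  ... | inj₂ (l , q) with B , b , x∈B ← At-concat xss q rewrite ≥⇒<ᵇ≡false l = B , there b , x∈B

module _ (n k : ℕ) (ns : List ℕ) {a b : ℕ} where

  Hadj-cycle-pendent : a < k → k ≤ b → Hadj n k ns a b ≡ (block ns (b ∸ k) ≡ᵇ a)
  Hadj-cycle-pendent a<k k≤b rewrite <⇒<ᵇ≡true a<k | ≥⇒<ᵇ≡false k≤b = refl

  Hadj-pendent-cycle : k ≤ a → b < k → Hadj n k ns a b ≡ (block ns (a ∸ k) ≡ᵇ b)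
  Hadj-pendent-cycle k≤a b<k rewrite <⇒<ᵇ≡true b<k | ≥⇒<ᵇ≡false k≤a = refl

  Hadj-pendent-pendent : k ≤ a → k ≤ b → Hadj n k ns a b ≡ false
  Hadj-pendent-pendent k≤a k≤b rewrite ≥⇒<ᵇ≡false k≤a | ≥⇒<ᵇ≡false k≤b = refl

module _ {n : ℕ} {L : List (Fin n)} (unique : Unique L) (complete : ∀ x → x ∈ L) where

  enumeration-length : length L ≡ n
  enumeration-length = ℕ.≤-antisym
    (subst (length L ≤_) (length-tabulate {n = n} (λ i → i)) (Unique∧⊆⇒length≤ unique λ {x} _ → ∈-allFin x))
    (subst (_≤ length L) (length-tabulate {n = n} (λ i → i)) (Unique∧⊆⇒length≤ (Unique.allFin⁺ n) λ {x} _ → complete x))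

  private
    to′ from′ : Fin n → Fin n
    to′ i = lookup L (cast (sym enumeration-length) i)
    from′ x = cast enumeration-length (index (complete x))

  At-to : ∀ i → At L (toℕ i) (to′ i)
  At-to i = subst (λ t → At L t (to′ i)) (Fin.toℕ-cast (sym enumeration-length) i) (At-lookup L _)

  At-from : ∀ x → At L (toℕ (from′ x)) x
  At-from x = subst (λ t → At L t x) (sym (Fin.toℕ-cast enumeration-length (index (complete x)))) (At-index (complete x))

  enumeration : Fin n ↔ Fin n
  enumeration = mk↔ₛ′ to′ from′
    (λ x → At-functional (At-to (from′ x)) (At-from x))
    (λ i → Fin.toℕ-injective (At-injective unique (At-from (to′ i)) (At-to i)))

module _ {n} (G : Graph n) (simple : IsSimple G) (vs : List (Fin n)) (As : List (List (Fin n)))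
  (unique : Unique (vs ++ concat As)) (complete : ∀ x → x ∈ vs ++ concat As) where

  private
    k = length vs
    ns = map length As

  -- Listing the cycle and then the pendent vertices, grouped by the cycle vertex carrying them,
  -- reproduces the numbering of `H`. The hypotheses treat the pairs cycle-cycle, cycle-pendent and
  -- pendent-pendent.
  pendents⇒≅H :
    (∀ {i j x y} → At vs i x → At vs j y → G x y ≡ Hadj n (length vs) (map length As) i j) →
    (∀ {i j x y B} → At vs i x → At As j B → y ∈ B → G x y ≡ (j ≡ᵇ i)) →
    (∀ {y z} → y ∈ concat As → z ∈ concat As → G y z ≡ false) →
    G ≅ H n (length vs) (map length As)
  pendents⇒≅H cyc pend out = enumeration unique complete , adjacency
    where
    split : ∀ u → _
    split u = At-++ vs (At-to unique complete u)
    adjacency : ∀ u v → G _ _ ≡ Hadj n k ns (toℕ u) (toℕ v)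
    adjacency u v with split u | split v
    ... | inj₁ p | inj₁ q = cyc p q
    ... | inj₁ p | inj₂ (l , q) with B , b , y∈ ← At-concat As q =
      trans (pend p b y∈) (sym (Hadj-cycle-pendent n k ns (At⇒< p) l))
    ... | inj₂ (l , p) | inj₁ q with B , b , y∈ ← At-concat As p =
      trans (proj₁ simple _ _) (trans (pend q b y∈) (sym (Hadj-pendent-cycle n k ns l (At⇒< q))))
    ... | inj₂ (l , p) | inj₂ (m , q) =
      trans (out (At⇒∈ p) (At⇒∈ q)) (sym (Hadj-pendent-pendent n k ns l m))

-- The structure of dominated unicyclic graphs

CycEdge-∈ : ∀ {n} {vs : List (Fin n)} {a b} → CycEdge vs a b → a ∈ vs
CycEdge-∈ {vs = x ∷ xs} (inj₁ p) = chain-∈₁ p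
CycEdge-∈ {vs = x ∷ xs} (inj₂ p) with chain-∈₂ p
... | inj₁ a∈ = there a∈
... | inj₂ refl = here refl

∈-CycEdge : ∀ {n} {vs : List (Fin n)} {a} → a ∈ vs → ∃ (CycEdge vs a)
∈-CycEdge {vs = x ∷ xs} a∈ with b , p ← chain-successor a∈ = b , inj₁ p

uncovered : ∀ {n} (vs : List (Fin n)) → length vs < n → ∃ λ x → x ∉ vs
uncovered {n} vs l = Fin.¬∀⟶∃¬ n (_∈ vs) (_∈? vs) λ cover →
  ℕ.<⇒≱ l (subst (_≤ length vs) (length-tabulate {n = n} (λ i → i)) (Unique∧⊆⇒length≤ (Unique.allFin⁺ n) λ {x} _ → cover x))

avoid : ∀ {n} {e : Fin n} {xs} → All (_≢ e) xs → e ∉ xs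
avoid all e∈ = All.lookup all e∈ refl

module _ {n} (G : Graph n) (simple : IsSimple G) where

  private
    _~_ : Fin n → Fin n → Set
    _~_ = Adj G

    ~sym : ∀ {u v} → u ~ v → v ~ u
    ~sym = Adj-sym G simple

    ~≢ : ∀ {u v} → u ~ v → u ≢ v
    ~≢ = Adj-≢ G simple

  Near-sym : ∀ {u v} → Near G u v → Near G v u
  Near-sym (inj₁ refl) = inj₁ refl
  Near-sym (inj₂ (inj₁ a)) = inj₂ (inj₁ (~sym a))
  Near-sym (inj₂ (inj₂ (w , a , b))) = inj₂ (inj₂ (w , ~sym b , ~sym a))

  triangle : ∀ {a b c} → a ~ b → b ~ c → c ~ a → IsCycle G (a ∷ b ∷ c ∷ [])
  triangle ab bc ca = s≤s (s≤s (s≤s z≤n)) , ((~≢ ab ∷ ≢-sym (~≢ ca) ∷ []) ∷ (~≢ bc ∷ []) ∷ [] ∷ []) , (ab ∷ bc ∷ ca ∷ [])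

  quadrilateral : ∀ {a b c d} → a ~ b → b ~ c → c ~ d → d ~ a → a ≢ c → b ≢ d → IsCycle G (a ∷ b ∷ c ∷ d ∷ [])
  quadrilateral ab bc cd da a≢c b≢d = s≤s (s≤s (s≤s z≤n)) ,
    ((~≢ ab ∷ a≢c ∷ ≢-sym (~≢ da) ∷ []) ∷ (~≢ bc ∷ b≢d ∷ []) ∷ (~≢ cd ∷ []) ∷ [] ∷ []) , (ab ∷ bc ∷ cd ∷ da ∷ [])

  pentagon : ∀ {a b c d e} → a ~ b → b ~ c → c ~ d → d ~ e → e ~ a →
             a ≢ c → a ≢ d → b ≢ d → b ≢ e → c ≢ e → IsCycle G (a ∷ b ∷ c ∷ d ∷ e ∷ [])
  pentagon ab bc cd de ea a≢c a≢d b≢d b≢e c≢e = s≤s (s≤s (s≤s z≤n)) ,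
    ((~≢ ab ∷ a≢c ∷ a≢d ∷ ≢-sym (~≢ ea) ∷ []) ∷ (~≢ bc ∷ b≢d ∷ b≢e ∷ []) ∷ (~≢ cd ∷ c≢e ∷ []) ∷ (~≢ de ∷ []) ∷ [] ∷ []) ,
    (ab ∷ bc ∷ cd ∷ de ∷ ea ∷ [])

  rotate₄ : ∀ {a b c d} → IsCycle G (a ∷ b ∷ c ∷ d ∷ []) → IsCycle G (b ∷ c ∷ d ∷ a ∷ [])
  rotate₄ (_ , ((_ ∷ a≢c ∷ _) ∷ (_ ∷ b≢d ∷ _) ∷ _) , (ab ∷ bc ∷ cd ∷ da ∷ [])) =
    quadrilateral bc cd da ab b≢d (≢-sym a≢c)

  rotate₅ : ∀ {a b c d e} → IsCycle G (a ∷ b ∷ c ∷ d ∷ e ∷ []) → IsCycle G (b ∷ c ∷ d ∷ e ∷ a ∷ [])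
  rotate₅ (_ , ((_ ∷ a≢c ∷ a≢d ∷ _) ∷ (_ ∷ b≢d ∷ b≢e ∷ _) ∷ (_ ∷ c≢e ∷ _) ∷ _) , (ab ∷ bc ∷ cd ∷ de ∷ ea ∷ [])) =
    pentagon bc cd de ea ab b≢d b≢e c≢e (≢-sym a≢c) (≢-sym a≢d)

  -- Either a and d are adjacent, or they have a common neighbour w. If w is b or c, it yields a
  -- chord of the path and thus a triangle; otherwise w is a fifth vertex.
  near⇒cycle : ∀ {a b c d} → a ~ b → b ~ c → c ~ d → a ≢ c → b ≢ d → a ≢ d → Near G a d →
               IsCycle G (a ∷ b ∷ c ∷ []) ⊎ IsCycle G (b ∷ c ∷ d ∷ []) ⊎
               IsCycle G (a ∷ b ∷ c ∷ d ∷ []) ⊎ ∃ λ w → IsCycle G (a ∷ b ∷ c ∷ d ∷ w ∷ [])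
  near⇒cycle ab bc cd a≢c b≢d a≢d (inj₁ a≡d) = ⊥-elim (a≢d a≡d)
  near⇒cycle ab bc cd a≢c b≢d a≢d (inj₂ (inj₁ ad)) = inj₂ (inj₂ (inj₁ (quadrilateral ab bc cd (~sym ad) a≢c b≢d)))
  near⇒cycle {b = b} {c} ab bc cd a≢c b≢d a≢d (inj₂ (inj₂ (w , aw , wd))) with b Fin.≟ w | c Fin.≟ w
  ... | yes refl | _ = inj₂ (inj₁ (triangle bc cd (~sym wd)))
  ... | no _ | yes refl = inj₁ (triangle ab bc (~sym aw))
  ... | no b≢w | no c≢w = inj₂ (inj₂ (inj₂ (w , pentagon ab bc cd (~sym wd) (~sym aw) a≢c a≢d b≢d b≢w c≢w)))

  module _ (connected : Connected G)
    (same : ∀ {ws ws′} → IsCycle G ws → IsCycle G ws′ → ∀ {x} → x ∈ ws → x ∈ ws′) where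

    -- For a vertex outside the given cycle this holds by `∉⇒Off`. Quantifying over all cycles lets
    -- any newly built cycle be refuted by pointing at the vertex on it.
    Off : Fin n → Set
    Off x = ∀ {ws} → IsCycle G ws → x ∉ ws

    ∉⇒Off : ∀ {vs x} → IsCycle G vs → x ∉ vs → Off x
    ∉⇒Off cyc x∉ cyc′ x∈ = x∉ (same cyc′ cyc x∈)

    Off-≢ : ∀ {vs x y} → IsCycle G vs → y ∈ vs → Off x → y ≢ x
    Off-≢ cyc y∈ off refl = off cyc y∈

    -- Of the four closings of the path, three contain d, which is on no cycle; the fourth is the
    -- excluded triangle.
    far-off : ∀ {a b c d} → a ~ b → b ~ c → c ~ d → a ≢ c → b ≢ d → a ≢ d →
              ¬ IsCycle G (a ∷ b ∷ c ∷ []) → Off d → ¬ Near G a d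
    far-off ab bc cd a≢c b≢d a≢d ¬abc off near with near⇒cycle ab bc cd a≢c b≢d a≢d near
    ... | inj₁ abc = ¬abc abc
    ... | inj₂ (inj₁ bcd) = off bcd (there (there (here refl)))
    ... | inj₂ (inj₂ (inj₁ abcd)) = off abcd (there (there (there (here refl))))
    ... | inj₂ (inj₂ (inj₂ (_ , abcdw))) = off abcdw (there (there (there (here refl))))

    -- A closing cycle has at most one vertex besides a, b, c, d. It cannot contain both e and f, as
    -- every cycle must.
    far-on-long-cycle : ∀ {vs a b c d e f} → IsCycle G vs → a ~ b → b ~ c → c ~ d → a ≢ c → b ≢ d → a ≢ d →
               e ∈ vs → f ∈ vs → e ≢ f → All (_≢ e) (a ∷ b ∷ c ∷ d ∷ []) → All (_≢ f) (a ∷ b ∷ c ∷ d ∷ []) →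
               ¬ Near G a d
    far-on-long-cycle cyc ab bc cd a≢c b≢d a≢d e∈ f∈ e≢f es@(ea ∷ eb ∷ ec ∷ ed ∷ []) fs@(fa ∷ fb ∷ fc ∷ fd ∷ []) near with near⇒cycle ab bc cd a≢c b≢d a≢d near
    ... | inj₁ abc = avoid (ea ∷ eb ∷ ec ∷ []) (same cyc abc e∈)
    ... | inj₂ (inj₁ bcd) = avoid (eb ∷ ec ∷ ed ∷ []) (same cyc bcd e∈)
    ... | inj₂ (inj₂ (inj₁ abcd)) = avoid es (same cyc abcd e∈)
    ... | inj₂ (inj₂ (inj₂ (w , abcdw))) = e≢f (trans (is-w es (same cyc abcdw e∈)) (sym (is-w fs (same cyc abcdw f∈))))
      where
      is-w : ∀ {x} → All (_≢ x) (_ ∷ _ ∷ _ ∷ _ ∷ []) → x ∈ _ ∷ _ ∷ _ ∷ _ ∷ w ∷ [] → x ≡ w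
      is-w xs x∈ with ∈-++⁻ (_ ∷ _ ∷ _ ∷ _ ∷ []) x∈
      ... | inj₁ p = ⊥-elim (avoid xs p)
      ... | inj₂ (here eq) = eq

    exit : ∀ {r rs z} k → z ∉ r ∷ rs → reach G k r z ≡ true → ∃ λ v → ∃ λ x → v ∈ r ∷ rs × x ∉ r ∷ rs × v ~ x
    exit zero z∉ h = ⊥-elim (z∉ (here (sym (reach-zero⁻ G h))))
    exit {r} {rs} {z} (suc k) z∉ h with reach-suc⁻ G k h
    ... | inj₁ h′ = exit k z∉ h′
    ... | inj₂ (w , h′ , wz) with w ∈? (r ∷ rs)
    ...   | yes w∈ = w , z , w∈ , z∉ , wz
    ...   | no w∉ = exit k w∉ h′

    attached : ∀ {vs} → IsCycle G vs → length vs < n → ∃ λ v → ∃ λ x → v ∈ vs × Off x × v ~ x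
    attached {r ∷ rs} cyc l with z , z∉ ← uncovered (r ∷ rs) l with k , h ← connected r z
      with v , x , v∈ , x∉ , a ← exit k z∉ h = v , x , v∈ , ∉⇒Off cyc x∉ , a

    -- `far-off` is applied to the path c, b, a, x; a triangle on c, b, a would miss d.
    opposite-far : ∀ {a b c d x} → IsCycle G (a ∷ b ∷ c ∷ d ∷ []) → Off x → a ~ x → ¬ Near G c x
    opposite-far cyc@(_ , ((ab ∷ ac ∷ ad ∷ []) ∷ (bc ∷ bd ∷ []) ∷ (cd ∷ []) ∷ _) , (a~b ∷ b~c ∷ _)) off a~x =
      far-off (~sym b~c) (~sym a~b) a~x (≢-sym ac) (Off-≢ cyc (there (here refl)) off) (Off-≢ cyc (there (there (here refl))) off)
        (λ t → avoid (cd ∷ bd ∷ ad ∷ []) (same cyc t (there (there (there (here refl)))))) off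

    Off-nonadjacent : ∀ {v y z} → v ~ y → v ~ z → Off y → ¬ y ~ z
    Off-nonadjacent vy vz off yz = off (triangle vy yz (~sym vz)) (there (here refl))

    pendent-exclusive : ∀ {s t y} → s ~ t → Off y → s ~ y → ¬ t ~ y
    pendent-exclusive s~t off s~y t~y = off (triangle s~t t~y (~sym s~y)) (there (there (here refl)))

    module _ (dominated : Dominated G) where

      -- If a is central, the path a, b, c, d is too short to close up, with e and f left over. If b
      -- is central, the same holds for b, c, d, e, with a and f left over.
      no-long-cycle : ∀ {a b c d e f xs} → ¬ IsCycle G (a ∷ b ∷ c ∷ d ∷ e ∷ f ∷ xs)
      no-long-cycle {a} {b} {c} {d} {e} {f} {xs} cyc@(_ ,
          ((ab ∷ ac ∷ ad ∷ ae ∷ af ∷ _) ∷ (bc ∷ bd ∷ be ∷ bf ∷ _) ∷ (cd ∷ ce ∷ cf ∷ _) ∷ (de ∷ df ∷ _) ∷ (ef ∷ _) ∷ _) ,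
          (a~b ∷ b~c ∷ c~d ∷ d~e ∷ e~f ∷ _)) with dominated a~b
      ... | inj₁ near = far-on-long-cycle cyc a~b b~c c~d ac bd ad
              (there (there (there (there (here refl))))) (there (there (there (there (there (here refl)))))) ef
              (ae ∷ be ∷ ce ∷ de ∷ []) (af ∷ bf ∷ cf ∷ df ∷ []) (near d)
      ... | inj₂ near = far-on-long-cycle cyc b~c c~d d~e bd ce be
              (here refl) (there (there (there (there (there (here refl)))))) af
              (≢-sym ab ∷ ≢-sym ac ∷ ≢-sym ad ∷ ≢-sym ae ∷ []) (bf ∷ cf ∷ df ∷ ef ∷ []) (near e)

      -- The edge cd is opposite to a. From its central end, the path to a through b or e continues
      -- to x, and this path of length three cannot close up.
      pentagon-no-pendent : ∀ {a b c d e x} → IsCycle G (a ∷ b ∷ c ∷ d ∷ e ∷ []) → Off x → ¬ a ~ x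
      pentagon-no-pendent {x = x} cyc@(_ , ((ab ∷ ac ∷ ad ∷ ae ∷ []) ∷ (bc ∷ bd ∷ be ∷ []) ∷ (cd ∷ ce ∷ []) ∷ (de ∷ []) ∷ _) ,
          (a~b ∷ b~c ∷ c~d ∷ d~e ∷ e~a ∷ [])) off a~x with dominated c~d
      ... | inj₁ near = far-off (~sym b~c) (~sym a~b) a~x (≢-sym ac) (Off-≢ cyc (there (here refl)) off)
              (Off-≢ cyc (there (there (here refl))) off)
              (λ t → avoid (cd ∷ bd ∷ ad ∷ []) (same cyc t (there (there (there (here refl)))))) off (near x)
      ... | inj₂ near = far-off d~e e~a a~x (≢-sym ad) (Off-≢ cyc (there (there (there (there (here refl))))) off)
              (Off-≢ cyc (there (there (there (here refl)))) off)
              (λ t → avoid (≢-sym bd ∷ ≢-sym be ∷ ab ∷ []) (same cyc t (there (here refl)))) off (near x)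

      -- The bare 5-cycle has all eccentricities equal to 2; only a sixth vertex excludes it.
      -- Rotation brings the place of attachment to the front.
      no-pentagon : 6 ≤ n → ∀ {a b c d e} → ¬ IsCycle G (a ∷ b ∷ c ∷ d ∷ e ∷ [])
      no-pentagon 6≤n cyc with attached cyc 6≤n
      ... | v , x , here refl , off , a = pentagon-no-pendent cyc off a
      ... | v , x , there (here refl) , off , a = pentagon-no-pendent (rotate₅ cyc) off a
      ... | v , x , there (there (here refl)) , off , a = pentagon-no-pendent (rotate₅ (rotate₅ cyc)) off a
      ... | v , x , there (there (there (here refl))) , off , a = pentagon-no-pendent (rotate₅ (rotate₅ (rotate₅ cyc))) off a
      ... | v , x , there (there (there (there (here refl)))) , off , a = pentagon-no-pendent (rotate₅ (rotate₅ (rotate₅ (rotate₅ cyc)))) off a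

      module _ {a b c d x} (cyc : IsCycle G (a ∷ b ∷ c ∷ d ∷ [])) (x-off : Off x) (a~x : a ~ x) where

        private
          vs : List (Fin n)
          vs = a ∷ b ∷ c ∷ d ∷ []
          adj : All (λ p → proj₁ p ~ proj₂ p) (cpairs vs)
          adj = proj₂ (proj₂ cyc)

        -- x hangs on the opposite corner a. As a consequence, the two edges at c force b and d to
        -- be central.
        c-eccentric : ¬ Central G c
        c-eccentric near = opposite-far cyc x-off a~x (near x)

        b-central : Central G b
        b-central with _ ∷ b~c ∷ _ ← adj with dominated b~c
        ... | inj₁ near = near
        ... | inj₂ near = ⊥-elim (c-eccentric near)

        d-central : Central G d
        d-central with _ ∷ _ ∷ c~d ∷ _ ← adj with dominated c~d
        ... | inj₁ near = ⊥-elim (c-eccentric near)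
        ... | inj₂ near = near

        b-no-pendent : ∀ {y} → Off y → ¬ b ~ y
        b-no-pendent {y} off b~y = opposite-far (rotate₄ cyc) off b~y (d-central y)

        d-no-pendent : ∀ {y} → Off y → ¬ d ~ y
        d-no-pendent {y} off d~y = opposite-far (rotate₄ (rotate₄ (rotate₄ cyc))) off d~y (b-central y)

        -- The edge ax decides: a central a would be too close to a vertex hanging on c, and a
        -- central x would be too close to c itself.
        c-no-pendent : ∀ {y} → Off y → ¬ c ~ y
        c-no-pendent {y} off c~y with dominated a~x
        ... | inj₁ near = opposite-far (rotate₄ (rotate₄ cyc)) off c~y (near y)
        ... | inj₂ near = opposite-far cyc x-off a~x (Near-sym (near c))

        -- The central vertex b gets to y in at most two steps. It has no neighbour off the cycle,
        -- and neither c nor d has one, so the middle vertex is a.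
        a-pendent : ∀ {y} → Off y → a ~ y
        a-pendent {y} off with b-central y
        ... | inj₁ refl = ⊥-elim (off cyc (there (here refl)))
        ... | inj₂ (inj₁ b~y) = ⊥-elim (b-no-pendent off b~y)
        ... | inj₂ (inj₂ (w , b~w , w~y)) with w ∈? vs
        ...   | no w∉ = ⊥-elim (b-no-pendent (∉⇒Off cyc w∉) b~w)
        ...   | yes (here refl) = w~y
        ...   | yes (there (here refl)) = ⊥-elim (~≢ b~w refl)
        ...   | yes (there (there (here refl))) = ⊥-elim (c-no-pendent off w~y)
        ...   | yes (there (there (there (here refl)))) = ⊥-elim (d-no-pendent off w~y)

        hub⇒≅H : G ≅ H n 4 (n ∸ 4 ∷ 0 ∷ 0 ∷ 0 ∷ [])
        hub⇒≅H = subst (λ m → G ≅ H n 4 (m ∷ 0 ∷ 0 ∷ 0 ∷ [])) length-B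
          (pendents⇒≅H G simple vs As unique complete cyc-adj pend out)
          where
          B : List (Fin n)
          B = filter (λ y → ¬? (y ∈? vs)) (allFin n)
          As : List (List (Fin n))
          As = B ∷ [] ∷ [] ∷ [] ∷ []
          B⇒∉ : ∀ {y} → y ∈ B → y ∉ vs
          B⇒∉ y∈ = proj₂ (∈-filter⁻ (λ y → ¬? (y ∈? vs)) {xs = allFin n} y∈)
          B⇒Off : ∀ {y} → y ∈ B → Off y
          B⇒Off y∈ = ∉⇒Off cyc (B⇒∉ y∈)
          concat-As : concat As ≡ B
          concat-As = ++-identityʳ B
          unique : Unique (vs ++ concat As)
          unique rewrite concat-As = Unique.++⁺ (proj₁ (proj₂ cyc)) (Unique.filter⁺ _ (Unique.allFin⁺ n)) λ (p , q) → B⇒∉ q p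
          complete : ∀ y → y ∈ vs ++ concat As
          complete y rewrite concat-As with y ∈? vs
          ... | yes y∈ = ∈-++⁺ˡ y∈
          ... | no y∉ = ∈-++⁺ʳ vs (∈-filter⁺ (λ y → ¬? (y ∈? vs)) (∈-allFin y) y∉)
          length-B : length B ≡ n ∸ 4
          length-B = trans (cong length (sym concat-As)) (cong (_∸ 4) (enumeration-length unique complete))
          a~b : a ~ b
          a~b = All.lookup adj (here refl)
          b~c : b ~ c
          b~c = All.lookup adj (there (here refl))
          c~d : c ~ d
          c~d = All.lookup adj (there (there (here refl)))
          d~a : d ~ a
          d~a = All.lookup adj (there (there (there (here refl))))
          -- A chord would cut off the triangle abc, which misses d.
          a≁c : G a c ≡ false
          a≁c with (_ ∷ _ ∷ ad ∷ []) ∷ (_ ∷ bd ∷ []) ∷ (cd ∷ []) ∷ _ ← proj₁ (proj₂ cyc) = ≢true⇒≡false λ ac →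
            avoid (ad ∷ bd ∷ cd ∷ []) (same cyc (triangle a~b b~c (~sym ac)) (there (there (there (here refl)))))
          b≁d : G b d ≡ false
          b≁d with (ab ∷ ac ∷ ad ∷ []) ∷ _ ← proj₁ (proj₂ cyc) = ≢true⇒≡false λ bd →
            avoid (≢-sym ab ∷ ≢-sym ac ∷ ≢-sym ad ∷ []) (same cyc (triangle b~c c~d (~sym bd)) (here refl))
          cyc-adj : ∀ {i j x y} → At vs i x → At vs j y → G x y ≡ Hadj n 4 (map length As) i j
          cyc-adj here here = proj₂ simple _
          cyc-adj here (there here) = a~b
          cyc-adj here (there (there here)) = a≁c
          cyc-adj here (there (there (there here))) = ~sym d~a
          cyc-adj (there here) here = ~sym a~b
          cyc-adj (there here) (there here) = proj₂ simple _
          cyc-adj (there here) (there (there here)) = b~c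
          cyc-adj (there here) (there (there (there here))) = b≁d
          cyc-adj (there (there here)) here = trans (proj₁ simple _ _) a≁c
          cyc-adj (there (there here)) (there here) = ~sym b~c
          cyc-adj (there (there here)) (there (there here)) = proj₂ simple _
          cyc-adj (there (there here)) (there (there (there here))) = c~d
          cyc-adj (there (there (there here))) here = d~a
          cyc-adj (there (there (there here))) (there here) = trans (proj₁ simple _ _) b≁d
          cyc-adj (there (there (there here))) (there (there here)) = ~sym c~d
          cyc-adj (there (there (there here))) (there (there (there here))) = proj₂ simple _
          pend : ∀ {i j x y B} → At vs i x → At As j B → y ∈ B → G x y ≡ (j ≡ᵇ i)
          pend here here y∈ = a-pendent (B⇒Off y∈)
          pend (there here) here y∈ = ≢true⇒≡false (b-no-pendent (B⇒Off y∈))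
          pend (there (there here)) here y∈ = ≢true⇒≡false (c-no-pendent (B⇒Off y∈))
          pend (there (there (there here))) here y∈ = ≢true⇒≡false (d-no-pendent (B⇒Off y∈))
          pend _ (there (there (there here))) ()
          out : ∀ {y z} → y ∈ concat As → z ∈ concat As → G y z ≡ false
          out y∈ z∈ = ≢true⇒≡false (Off-nonadjacent (a-pendent (off y∈)) (a-pendent (off z∈)) (off y∈))
            where
            off : ∀ {y} → y ∈ concat As → Off y
            off y∈ = B⇒Off (subst (_ ∈_) concat-As y∈)

      module _ {a b c} (cyc : IsCycle G (a ∷ b ∷ c ∷ [])) where

        private
          vs : List (Fin n)
          vs = a ∷ b ∷ c ∷ []
          a~b : a ~ b
          a~b = All.lookup (proj₂ (proj₂ cyc)) (here refl)
          b~c : b ~ c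
          b~c = All.lookup (proj₂ (proj₂ cyc)) (there (here refl))
          c~a : c ~ a
          c~a = All.lookup (proj₂ (proj₂ cyc)) (there (there (here refl)))

        -- Suppose the middle vertices w and w′ on the ways from u and v to y are both off the
        -- triangle. If they coincide, they form a triangle with uv; if not, y, w, u, v, w′ is a
        -- 5-cycle through y.
        central-pair : ∀ {u v} → u ∈ vs → v ∈ vs → u ~ v → Central G u → Central G v →
                       ∀ {y} → Off y → ∃ λ t → t ∈ vs × t ~ y
        central-pair {u} {v} u∈ v∈ u~v near-u near-v {y} off with near-u y | near-v y
        ... | inj₁ refl | _ = ⊥-elim (off cyc u∈)
        ... | inj₂ (inj₁ u~y) | _ = u , u∈ , u~y
        ... | _ | inj₁ refl = ⊥-elim (off cyc v∈)
        ... | _ | inj₂ (inj₁ v~y) = v , v∈ , v~y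
        ... | inj₂ (inj₂ (w , u~w , w~y)) | inj₂ (inj₂ (w′ , v~w′ , w′~y)) with w ∈? vs | w′ ∈? vs | w Fin.≟ w′
        ...   | yes w∈ | _ | _ = w , w∈ , w~y
        ...   | no _ | yes w′∈ | _ = w′ , w′∈ , w′~y
        ...   | no w∉ | no _ | yes refl = ⊥-elim (w∉ (same (triangle u~v v~w′ (~sym u~w)) cyc (there (there (here refl)))))
        ...   | no w∉ | no w′∉ | no w≢w′ = ⊥-elim (off
                  (pentagon (~sym w~y) (~sym u~w) u~v v~w′ w′~y (≢-sym (Off-≢ cyc u∈ off)) (≢-sym (Off-≢ cyc v∈ off))
                    (≢-sym (Off-≢ cyc v∈ (∉⇒Off cyc w∉))) w≢w′ (Off-≢ cyc u∈ (∉⇒Off cyc w′∉)))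
                  (here refl))

        -- All three edges of the triangle have a central end, so at least two of its vertices are
        -- central.
        pendent : ∀ {y} → Off y → ∃ λ t → t ∈ vs × t ~ y
        pendent with dominated a~b | dominated b~c | dominated c~a
        ... | inj₁ na | inj₁ nb | _ = central-pair (here refl) (there (here refl)) a~b na nb
        ... | inj₁ na | inj₂ nc | _ = central-pair (here refl) (there (there (here refl))) (~sym c~a) na nc
        ... | inj₂ nb | _ | inj₁ nc = central-pair (there (here refl)) (there (there (here refl))) b~c nb nc
        ... | inj₂ nb | _ | inj₂ na = central-pair (here refl) (there (here refl)) a~b na nb

        vs-adjacent : ∀ {s t} → s ∈ vs → t ∈ vs → s ≡ t ⊎ s ~ t
        vs-adjacent (here refl) (here refl) = inj₁ refl
        vs-adjacent (here refl) (there (here refl)) = inj₂ a~b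
        vs-adjacent (here refl) (there (there (here refl))) = inj₂ (~sym c~a)
        vs-adjacent (there (here refl)) (here refl) = inj₂ (~sym a~b)
        vs-adjacent (there (here refl)) (there (here refl)) = inj₁ refl
        vs-adjacent (there (here refl)) (there (there (here refl))) = inj₂ b~c
        vs-adjacent (there (there (here refl))) (here refl) = inj₂ c~a
        vs-adjacent (there (there (here refl))) (there (here refl)) = inj₂ (~sym b~c)
        vs-adjacent (there (there (here refl))) (there (there (here refl))) = inj₁ refl

        -- An edge yz would lie on a triangle if y and z hang on the same vertex, and on a 4-cycle
        -- otherwise.
        pendents-nonadjacent : ∀ {y z} → Off y → Off z → ¬ y ~ z
        pendents-nonadjacent off-y off-z y~z with pendent off-y | pendent off-z
        ... | s , s∈ , s~y | t , t∈ , t~z with vs-adjacent s∈ t∈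
        ...   | inj₁ refl = Off-nonadjacent s~y t~z off-y y~z
        ...   | inj₂ s~t = off-y (quadrilateral (~sym s~y) s~t t~z (~sym y~z) (≢-sym (Off-≢ cyc t∈ off-y)) (Off-≢ cyc s∈ off-z)) (here refl)

        triangle⇒≅H : Σ ℕ λ n₁ → Σ ℕ λ n₂ → Σ ℕ λ n₃ → (n₁ + n₂ + n₃ ≡ n ∸ 3) × (G ≅ H n 3 (n₁ ∷ n₂ ∷ n₃ ∷ []))
        triangle⇒≅H = length (B a) , length (B b) , length (B c) , total ,
          pendents⇒≅H G simple vs As unique complete cyc-adj pend out
          where
          InB? : ∀ t y → Dec (y ∉ vs × t ~ y)
          InB? t y = ¬? (y ∈? vs) ×-dec (G t y Bool.≟ true)
          B : Fin n → List (Fin n)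
          B t = filter (InB? t) (allFin n)
          As : List (List (Fin n))
          As = B a ∷ B b ∷ B c ∷ []
          B⇒ : ∀ t {y} → y ∈ B t → y ∉ vs × t ~ y
          B⇒ t y∈ = proj₂ (∈-filter⁻ (InB? t) {xs = allFin n} y∈)
          As⇒∉ : ∀ {y} → y ∈ concat As → y ∉ vs
          As⇒∉ y∈ with ∈-concat⁻′ As y∈
          ... | _ , y∈B , here refl = proj₁ (B⇒ a y∈B)
          ... | _ , y∈B , there (here refl) = proj₁ (B⇒ b y∈B)
          ... | _ , y∈B , there (there (here refl)) = proj₁ (B⇒ c y∈B)
          B∈As : ∀ {t} → t ∈ vs → B t ∈ As
          B∈As = ∈-map⁺ B
          B-unique : ∀ t → Unique (B t)
          B-unique t = Unique.filter⁺ (InB? t) (Unique.allFin⁺ n)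
          B-disjoint : ∀ {s t} → s ~ t → ∀ {y} → ¬ (y ∈ B s × y ∈ B t)
          B-disjoint s~t (y∈s , y∈t) = pendent-exclusive s~t (∉⇒Off cyc (proj₁ (B⇒ _ y∈s))) (proj₂ (B⇒ _ y∈s)) (proj₂ (B⇒ _ y∈t))
          unique : Unique (vs ++ concat As)
          unique = Unique.++⁺ (proj₁ (proj₂ cyc))
            (Unique.concat⁺ (B-unique a ∷ B-unique b ∷ B-unique c ∷ [])
              ((B-disjoint a~b ∷ B-disjoint (~sym c~a) ∷ []) ∷ (B-disjoint b~c ∷ []) ∷ [] ∷ []))
            λ (p , q) → As⇒∉ q p
          complete : ∀ y → y ∈ vs ++ concat As
          complete y with y ∈? vs
          ... | yes y∈ = ∈-++⁺ˡ {xs = vs} y∈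
          ... | no y∉ with t , t∈ , t~y ← pendent (∉⇒Off cyc y∉) =
            ∈-++⁺ʳ vs (∈-concat⁺′ (∈-filter⁺ (InB? t) (∈-allFin y) (y∉ , t~y)) (B∈As t∈))
          total : length (B a) + length (B b) + length (B c) ≡ n ∸ 3
          total = begin
            length (B a) + length (B b) + length (B c)          ≡⟨ ℕ.+-assoc (length (B a)) _ _ ⟩
            length (B a) + (length (B b) + length (B c))        ≡⟨ cong (λ xs → length (B a) + (length (B b) + length xs)) (++-identityʳ (B c)) ⟨
            length (B a) + (length (B b) + length (B c ++ []))  ≡⟨ cong (length (B a) +_) (length-++ (B b)) ⟨
            length (B a) + length (B b ++ B c ++ [])            ≡⟨ length-++ (B a) ⟨
            length (concat As)                                  ≡⟨ cong (_∸ 3) (enumeration-length unique complete) ⟩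
            n ∸ 3                                               ∎
            where open ≡-Reasoning
          cyc-adj : ∀ {i j x y} → At vs i x → At vs j y → G x y ≡ Hadj n 3 (map length As) i j
          cyc-adj here here = proj₂ simple _
          cyc-adj here (there here) = a~b
          cyc-adj here (there (there here)) = ~sym c~a
          cyc-adj (there here) here = ~sym a~b
          cyc-adj (there here) (there here) = proj₂ simple _
          cyc-adj (there here) (there (there here)) = b~c
          cyc-adj (there (there here)) here = c~a
          cyc-adj (there (there here)) (there here) = ~sym b~c
          cyc-adj (there (there here)) (there (there here)) = proj₂ simple _
          not-pend : ∀ {s t y} → s ~ t → y ∈ B s → G t y ≡ false
          not-pend s~t y∈ = ≢true⇒≡false (pendent-exclusive s~t (∉⇒Off cyc (proj₁ (B⇒ _ y∈))) (proj₂ (B⇒ _ y∈)))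
          pend : ∀ {i j x y A} → At vs i x → At As j A → y ∈ A → G x y ≡ (j ≡ᵇ i)
          pend here here y∈ = proj₂ (B⇒ _ y∈)
          pend here (there here) y∈ = not-pend (~sym a~b) y∈
          pend here (there (there here)) y∈ = not-pend c~a y∈
          pend (there here) here y∈ = not-pend a~b y∈
          pend (there here) (there here) y∈ = proj₂ (B⇒ _ y∈)
          pend (there here) (there (there here)) y∈ = not-pend (~sym b~c) y∈
          pend (there (there here)) here y∈ = not-pend (~sym c~a) y∈
          pend (there (there here)) (there here) y∈ = not-pend b~c y∈
          pend (there (there here)) (there (there here)) y∈ = proj₂ (B⇒ _ y∈)
          out : ∀ {y z} → y ∈ concat As → z ∈ concat As → G y z ≡ false
          out y∈ z∈ = ≢true⇒≡false (pendents-nonadjacent (∉⇒Off cyc (As⇒∉ y∈)) (∉⇒Off cyc (As⇒∉ z∈)))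

      quadrilateral⇒≅H : 6 ≤ n → ∀ {a b c d} → IsCycle G (a ∷ b ∷ c ∷ d ∷ []) → G ≅ H n 4 (n ∸ 4 ∷ 0 ∷ 0 ∷ 0 ∷ [])
      quadrilateral⇒≅H 6≤n cyc with attached cyc (ℕ.≤-trans (ℕ.n≤1+n 5) 6≤n)
      ... | v , x , here refl , off , v~x = hub⇒≅H cyc off v~x
      ... | v , x , there (here refl) , off , v~x = hub⇒≅H (rotate₄ cyc) off v~x
      ... | v , x , there (there (here refl)) , off , v~x = hub⇒≅H (rotate₄ (rotate₄ cyc)) off v~x
      ... | v , x , there (there (there (here refl))) , off , v~x = hub⇒≅H (rotate₄ (rotate₄ (rotate₄ cyc))) off v~x

      dominated⇒≅H : 6 ≤ n → ∀ vs → IsCycle G vs →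
        (Σ ℕ λ n₁ → Σ ℕ λ n₂ → Σ ℕ λ n₃ → (n₁ + n₂ + n₃ ≡ n ∸ 3) × (G ≅ H n 3 (n₁ ∷ n₂ ∷ n₃ ∷ [])))
        ⊎ (G ≅ H n 4 (n ∸ 4 ∷ 0 ∷ 0 ∷ 0 ∷ []))
      dominated⇒≅H _ (_ ∷ []) (s≤s () , _)
      dominated⇒≅H _ (_ ∷ _ ∷ []) (s≤s (s≤s ()) , _)
      dominated⇒≅H _ (_ ∷ _ ∷ _ ∷ []) cyc = inj₁ (triangle⇒≅H cyc)
      dominated⇒≅H 6≤n (_ ∷ _ ∷ _ ∷ _ ∷ []) cyc = inj₂ (quadrilateral⇒≅H 6≤n cyc)
      dominated⇒≅H 6≤n (_ ∷ _ ∷ _ ∷ _ ∷ _ ∷ []) cyc = ⊥-elim (no-pentagon 6≤n cyc)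
      dominated⇒≅H _ (_ ∷ _ ∷ _ ∷ _ ∷ _ ∷ _ ∷ _) cyc = ⊥-elim (no-long-cycle cyc)

-- The extremal graphs are dominated

≅-Dominated : ∀ {n} {G K : Graph n} → G ≅ K → Dominated K → Dominated G
≅-Dominated {n} {G} {K} (σ , adj) dom {u} {v} uv =
  Sum.map (transfer u) (transfer v) (dom (trans (sym (adj _ _)) (trans (cong₂ G (φφ⁻¹ u) (φφ⁻¹ v)) uv)))
  where
  open Inverse σ using () renaming (to to φ; from to φ⁻¹; strictlyInverseˡ to φφ⁻¹)
  near : ∀ {i j} → Near K i j → Near G (φ i) (φ j)
  near (inj₁ eq) = inj₁ (cong φ eq)
  near (inj₂ (inj₁ a)) = inj₂ (inj₁ (trans (adj _ _) a))
  near (inj₂ (inj₂ (w , a , b))) = inj₂ (inj₂ (φ w , trans (adj _ _) a , trans (adj _ _) b))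
  transfer : ∀ x → Central K (φ⁻¹ x) → Central G x
  transfer x central w = subst₂ (Near G) (φφ⁻¹ x) (φφ⁻¹ w) (near (central (φ⁻¹ w)))

module _ {m : ℕ} (n₁ n₂ n₃ : ℕ) (total : n₁ + n₂ + n₃ ≡ m) where

  private
    ns : List ℕ
    ns = n₁ ∷ n₂ ∷ n₃ ∷ []
    K : Graph (3 + m)
    K = H (3 + m) 3 ns

  third-block : ∀ {t} → t < m → n₁ ≤ t → n₂ ≤ t ∸ n₁ → t ∸ n₁ ∸ n₂ < n₃
  third-block {t} t<m p q = ℕ.+-cancelˡ-< (n₁ + n₂) _ _ (subst₂ _<_ (sym (begin
    n₁ + n₂ + (t ∸ n₁ ∸ n₂)     ≡⟨ ℕ.+-assoc n₁ n₂ _ ⟩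
    n₁ + (n₂ + (t ∸ n₁ ∸ n₂))   ≡⟨ cong (n₁ +_) (ℕ.m+[n∸m]≡n q) ⟩
    n₁ + (t ∸ n₁)               ≡⟨ ℕ.m+[n∸m]≡n p ⟩
    t                           ∎)) (sym total) t<m)
    where open ≡-Reasoning

  -- `block` would run past the last list only for positions from n₁ + n₂ + n₃ = m on. So every
  -- pendent vertex really hangs on the triangle.
  block<3 : ∀ {t} → t < m → block ns t < 3
  block<3 {t} t<m with t ℕ.<? n₁
  ... | yes p rewrite <⇒<ᵇ≡true p = s≤s z≤n
  ... | no p rewrite ≥⇒<ᵇ≡false (ℕ.≮⇒≥ p) with t ∸ n₁ ℕ.<? n₂
  ...   | yes q rewrite <⇒<ᵇ≡true q = s≤s (s≤s z≤n)
  ...   | no q rewrite ≥⇒<ᵇ≡false (ℕ.≮⇒≥ q) | <⇒<ᵇ≡true (third-block t<m (ℕ.≮⇒≥ p) (ℕ.≮⇒≥ q)) = s≤s (s≤s (s≤s z≤n))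

  pendent-neighbour : ∀ (t : Fin m) → let w = suc (suc (suc t)) in
    Adj K zero w ⊎ Adj K (suc zero) w ⊎ Adj K (suc (suc zero)) w
  pendent-neighbour t with block ns (toℕ t) | block<3 (Fin.toℕ<n t)
  ... | 0 | _ = inj₁ refl
  ... | 1 | _ = inj₂ (inj₁ refl)
  ... | 2 | _ = inj₂ (inj₂ refl)
  ... | suc (suc (suc _)) | s≤s (s≤s (s≤s ()))

  central₀ : Central K zero
  central₀ zero = inj₁ refl
  central₀ (suc zero) = inj₂ (inj₁ refl)
  central₀ (suc (suc zero)) = inj₂ (inj₁ refl)
  central₀ (suc (suc (suc t))) with pendent-neighbour t
  ... | inj₁ a = inj₂ (inj₁ a)
  ... | inj₂ (inj₁ a) = inj₂ (inj₂ (suc zero , refl , a))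
  ... | inj₂ (inj₂ a) = inj₂ (inj₂ (suc (suc zero) , refl , a))

  central₁ : Central K (suc zero)
  central₁ zero = inj₂ (inj₁ refl)
  central₁ (suc zero) = inj₁ refl
  central₁ (suc (suc zero)) = inj₂ (inj₁ refl)
  central₁ (suc (suc (suc t))) with pendent-neighbour t
  ... | inj₁ a = inj₂ (inj₂ (zero , refl , a))
  ... | inj₂ (inj₁ a) = inj₂ (inj₁ a)
  ... | inj₂ (inj₂ a) = inj₂ (inj₂ (suc (suc zero) , refl , a))

  central₂ : Central K (suc (suc zero))
  central₂ zero = inj₂ (inj₁ refl)
  central₂ (suc zero) = inj₂ (inj₁ refl)
  central₂ (suc (suc zero)) = inj₁ refl
  central₂ (suc (suc (suc t))) with pendent-neighbour t
  ... | inj₁ a = inj₂ (inj₂ (zero , refl , a))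
  ... | inj₂ (inj₁ a) = inj₂ (inj₂ (suc zero , refl , a))
  ... | inj₂ (inj₂ a) = inj₂ (inj₁ a)

  -- Every other vertex hangs on the triangle, so the triangle vertices are central, and no edge
  -- joins two pendent vertices.
  H₃-Dominated : Dominated K
  H₃-Dominated {zero} _ = inj₁ central₀
  H₃-Dominated {suc zero} _ = inj₁ central₁
  H₃-Dominated {suc (suc zero)} _ = inj₁ central₂
  H₃-Dominated {suc (suc (suc _))} {zero} _ = inj₂ central₀
  H₃-Dominated {suc (suc (suc _))} {suc zero} _ = inj₂ central₁
  H₃-Dominated {suc (suc (suc _))} {suc (suc zero)} _ = inj₂ central₂
  H₃-Dominated {suc (suc (suc _))} {suc (suc (suc _))} ()

module _ (m : ℕ) where

  private
    ns : List ℕ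
    ns = m ∷ 0 ∷ 0 ∷ 0 ∷ []
    K : Graph (4 + m)
    K = H (4 + m) 4 ns
    v₃ : Fin (4 + m)
    v₃ = suc (suc (suc zero))

  block≡0 : ∀ (t : Fin m) → block ns (toℕ t) ≡ 0
  block≡0 t rewrite <⇒<ᵇ≡true (Fin.toℕ<n t) = refl

  pendent-hub : ∀ (t : Fin m) → Adj K zero (suc (suc (suc (suc t))))
  pendent-hub t rewrite block≡0 t = refl

  pendent≁v₂ : ∀ (t : Fin m) → Adj K (suc (suc zero)) (suc (suc (suc (suc t)))) → ⊥
  pendent≁v₂ t a rewrite block≡0 t = false≢true a

  hub-central : Central K zero
  hub-central zero = inj₁ refl
  hub-central (suc zero) = inj₂ (inj₁ refl)
  hub-central (suc (suc zero)) = inj₂ (inj₂ (suc zero , refl , refl))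
  hub-central (suc (suc (suc zero))) = inj₂ (inj₁ refl)
  hub-central (suc (suc (suc (suc t)))) = inj₂ (inj₁ (pendent-hub t))

  v₁-central : Central K (suc zero)
  v₁-central zero = inj₂ (inj₁ refl)
  v₁-central (suc zero) = inj₁ refl
  v₁-central (suc (suc zero)) = inj₂ (inj₁ refl)
  v₁-central (suc (suc (suc zero))) = inj₂ (inj₂ (zero , refl , refl))
  v₁-central (suc (suc (suc (suc t)))) = inj₂ (inj₂ (zero , refl , pendent-hub t))

  v₃-central : Central K v₃
  v₃-central zero = inj₂ (inj₁ refl)
  v₃-central (suc zero) = inj₂ (inj₂ (zero , refl , refl))
  v₃-central (suc (suc zero)) = inj₂ (inj₁ refl)
  v₃-central (suc (suc (suc zero))) = inj₁ refl
  v₃-central (suc (suc (suc (suc t)))) = inj₂ (inj₂ (zero , refl , pendent-hub t))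

  -- Among the cycle vertices only number 2, opposite the hub, can fail to be central, and its only
  -- neighbours are the central vertices 1 and 3.
  H₄-Dominated : Dominated K
  H₄-Dominated {zero} _ = inj₁ hub-central
  H₄-Dominated {suc zero} _ = inj₁ v₁-central
  H₄-Dominated {suc (suc (suc zero))} _ = inj₁ v₃-central
  H₄-Dominated {_} {zero} _ = inj₂ hub-central
  H₄-Dominated {_} {suc zero} _ = inj₂ v₁-central
  H₄-Dominated {_} {suc (suc (suc zero))} _ = inj₂ v₃-central
  H₄-Dominated {suc (suc zero)} {suc (suc zero)} ()
  H₄-Dominated {suc (suc zero)} {suc (suc (suc (suc t)))} a = ⊥-elim (pendent≁v₂ t a)
  H₄-Dominated {suc (suc (suc (suc t)))} {suc (suc zero)} a = ⊥-elim (pendent≁v₂ t a)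
  H₄-Dominated {suc (suc (suc (suc _)))} {suc (suc (suc (suc _)))} ()

-- Eccentricities and the value of the sum

module _ {n} (G : Graph n) (6≤n : 6 ≤ n) (simple : IsSimple G)
  (same : ∀ {ws ws′} → IsCycle G ws → IsCycle G ws′ → ∀ {x} → x ∈ ws → x ∈ ws′) where

  private
    k<n : ∀ {k} → k ≤ 5 → k < n
    k<n k≤5 = ℕ.≤-trans (s≤s k≤5) 6≤n

  ecc≤2⇒Central : ∀ {u} → ecc G u ≤ 2 → Central G u
  ecc≤2⇒Central e w = reach₂⁻ G (ecc≤⇒reach G (k<n (s≤s (s≤s z≤n))) e w)

  Central⇒ecc≤2 : ∀ {u} → Central G u → ecc G u ≤ 2
  Central⇒ecc≤2 c = reach⇒ecc≤ G λ w → reach₂⁺ G (c w)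

  ecc≤1⇒Adj : ∀ {u w} → ecc G u ≤ 1 → u ≢ w → Adj G u w
  ecc≤1⇒Adj {w = w} e u≢w with reach₁⁻ G (ecc≤⇒reach G (k<n (s≤s z≤n)) e w)
  ... | inj₁ u≡w = ⊥-elim (u≢w u≡w)
  ... | inj₂ a = a

  ecc-positive : ∀ u → 1 ≤ ecc G u
  ecc-positive u = ℕ.≮⇒≥ λ e<1 → let w , w∉ = uncovered (u ∷ []) (k<n (s≤s z≤n)) in
    w∉ (here (sym (reach-zero⁻ G (ecc≤⇒reach G (k<n z≤n) (ℕ.≤-pred e<1) w))))

  -- Everything is at most one step beyond u. This supplies the side conditions of `half-bound`.
  ecc≤1⇒neighbour-ecc≤2 : ∀ {u v} → Adj G u v → ecc G u ≤ 1 → ecc G v ≤ 2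
  ecc≤1⇒neighbour-ecc≤2 {u} {v} uv e = Central⇒ecc≤2 central
    where
    central : Central G v
    central w with u Fin.≟ w
    ... | yes refl = inj₂ (inj₁ (Adj-sym G simple uv))
    ... | no u≢w = inj₂ (inj₂ (u , Adj-sym G simple uv , ecc≤1⇒Adj e u≢w))

  -- Two universal vertices would lie on several triangles.
  ¬both-universal : ∀ {u v} → Adj G u v → ecc G u ≤ 1 → ecc G v ≤ 1 → ⊥
  ¬both-universal {u} {v} uv eu ev
    with w , w∉ ← uncovered (u ∷ v ∷ []) (k<n (s≤s (s≤s z≤n)))
    with w′ , w′∉ ← uncovered (u ∷ v ∷ w ∷ []) (k<n (s≤s (s≤s (s≤s z≤n)))) =
    w′∉ (same (uv-triangle (λ { refl → w′∉ (here refl) }) (λ { refl → w′∉ (there (here refl)) }))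
              (uv-triangle (λ { refl → w∉ (here refl) }) (λ { refl → w∉ (there (here refl)) }))
              (there (there (here refl))))
    where
    uv-triangle : ∀ {w} → u ≢ w → v ≢ w → IsCycle G (u ∷ v ∷ w ∷ [])
    uv-triangle u≢w v≢w = triangle G simple uv (ecc≤1⇒Adj ev v≢w) (Adj-sym G simple (ecc≤1⇒Adj eu u≢w))

  terms-HalfBounded : All HalfBounded (map (term G) (edges G))
  terms-HalfBounded = All.map⁺ (All.tabulate λ {e} e∈ → bounded e (proj₂ (∈-edges⁻ G simple e∈)))
    where
    bounded : ∀ e → Adj G (proj₁ e) (proj₂ e) → HalfBounded (term G e)
    bounded (u , v) uv = ℕ.*-mono-≤ (ecc-positive u) (ecc-positive v) ,
      half-bound (ecc-positive u) (ecc-positive v) (ecc≤1⇒neighbour-ecc≤2 uv) (ecc≤1⇒neighbour-ecc≤2 (Adj-sym G simple uv))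

  Dominated⇒terms-tight : Dominated G → All (λ (p , q) → 1 * q ≤ p * 2) (map (term G) (edges G))
  Dominated⇒terms-tight dom = All.map⁺ (All.tabulate λ {e} e∈ → tight e (proj₂ (∈-edges⁻ G simple e∈)))
    where
    tight : ∀ e → Adj G (proj₁ e) (proj₂ e) → 1 * proj₂ (term G e) ≤ proj₁ (term G e) * 2
    tight (u , v) uv = tight-bound (ecc-positive u) (ecc-positive v) (¬both-universal uv)
      (Sum.map Central⇒ecc≤2 Central⇒ecc≤2 (dom uv))

  -- An edge with both eccentricities at least 3 has a term at most 4/9, and then `half-≰√` keeps
  -- the sum strictly below n√½.
  half-≤√⇒Dominated : length (edges G) ≤ n → nSqrtHalf n ≤√ map (term G) (edges G) → Dominated G
  half-≤√⇒Dominated len half≤ {u} {v} uv with ecc G u ℕ.≤? 2 | ecc G v ℕ.≤? 2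
  ... | yes e | _ = inj₁ (ecc≤2⇒Central e)
  ... | no _ | yes e = inj₂ (ecc≤2⇒Central e)
  ... | no eu | no ev = ⊥-elim (half-≰√ terms-HalfBounded
      (subst (_≤ n) (sym (length-map (term G) (edges G))) len) small half≤)
    where
    small : Any (λ (p , q) → p * 9 ≤ 4 * q) (map (term G) (edges G))
    -- `edges` lists each edge only with its smaller end first, so the orientation has to be found.
    small with ℕ.<-cmp (toℕ u) (toℕ v)
    ... | tri< u<v _ _ = lose (∈-map⁺ (term G) (∈-edges⁺ G simple u<v uv)) (strict-bound (ℕ.≰⇒> eu) (ℕ.≰⇒> ev))
    ... | tri≈ _ u≡v _ = ⊥-elim (Adj-≢ G simple uv (Fin.toℕ-injective u≡v))
    ... | tri> _ _ v<u = lose (∈-map⁺ (term G) (∈-edges⁺ G simple v<u (Adj-sym G simple uv))) (strict-bound (ℕ.≰⇒> ev) (ℕ.≰⇒> eu))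

extremal⇒Dominated : ∀ {n} {G : Graph n} → 6 ≤ n →
  (Σ ℕ λ n₁ → Σ ℕ λ n₂ → Σ ℕ λ n₃ → (n₁ + n₂ + n₃ ≡ n ∸ 3) × (G ≅ H n 3 (n₁ ∷ n₂ ∷ n₃ ∷ [])))
  ⊎ (G ≅ H n 4 (n ∸ 4 ∷ 0 ∷ 0 ∷ 0 ∷ [])) → Dominated G
-- Matching on the bound exposes n as 3 + m, so that `n ∸ 3` computes to m.
extremal⇒Dominated (s≤s (s≤s (s≤s _))) (inj₁ (n₁ , n₂ , n₃ , total , iso)) =
  ≅-Dominated iso (H₃-Dominated n₁ n₂ n₃ total)
extremal⇒Dominated (s≤s (s≤s (s≤s (s≤s {n = m} _)))) (inj₂ iso) =
  ≅-Dominated iso (H₄-Dominated m)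

theorem2p6 : (n : ℕ) (G : Graph n) → 6 ≤ n → IsSimple G → Unicyclic G →
    (abc3Terms G ≤√ nSqrtHalf n)
    × ((abc3Terms G ≈√ nSqrtHalf n)
    ⇔ ((Σ ℕ λ n₁ → Σ ℕ λ n₂ → Σ ℕ λ n₃ →
    (n₁ + n₂ + n₃ ≡ n ∸ 3) × (G ≅ H n 3 (n₁ ∷ n₂ ∷ n₃ ∷ [])))
    ⊎ (G ≅ H n 4 (n ∸ 4 ∷ 0 ∷ 0 ∷ 0 ∷ []))))
theorem2p6 n G 6≤n simple (connected , r ∷ rs , cycle , unique) rewrite abc3Terms-edges G =
  upper , mk⇔ (λ (_ , lower) → dominated⇒≅H G simple connected same
                  (half-≤√⇒Dominated G 6≤n simple same (ℕ.≤-reflexive size) lower) 6≤n (r ∷ rs) cycle)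
              (λ iso → upper , attained (extremal⇒Dominated 6≤n iso))
  where
  -- Both cycles are compared with `r ∷ rs`. Each vertex of a cycle is an end of one of its edges,
  -- so equal edge sets give equal vertex sets.
  same : ∀ {ws ws′} → IsCycle G ws → IsCycle G ws′ → ∀ {x} → x ∈ ws → x ∈ ws′
  same {ws} {ws′} c c′ {x} x∈ with y , e ← ∈-CycEdge x∈ =
    CycEdge-∈ (to (unique ws′ c′ x y) (from (unique ws c x y) e))
  size : length (edges G) ≡ n
  size = length-edges G simple connected cycle unique
  size′ : length (map (term G) (edges G)) ≡ n
  size′ = trans (length-map (term G) (edges G)) size
  upper : map (term G) (edges G) ≤√ nSqrtHalf n
  upper = ≤√-half (terms-HalfBounded G 6≤n simple same) (ℕ.≤-reflexive size′)
  attained : Dominated G → nSqrtHalf n ≤√ map (term G) (edges G)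
  attained dom = subst (λ k → nSqrtHalf k ≤√ map (term G) (edges G)) size′
    (half-≤√ (Dominated⇒terms-tight G 6≤n simple same dom))
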